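{- Let $p\geq 2$ and let $G$ be a finite simple $\{pK_2, K_5-e\}$-free graph. Then $\chi(G)\leq f_p(\omega(G))$, where $f_p:\mathbb{N}\to\mathbb{N}$ ($p\geq2$) is defined as follows. First let $g_p$ ($p\geq2$) be given by $g_t(1)=1$ ($t\geq2$), $g_2(2)=3$, $g_2(m)=m$ ($m\geq3$), $g_p(2)=2p-2$ ($p\geq3$), $g_p(m)=g_{p-1}(m)+2m-2$ ($p,m\geq3$). Then $f_t(1)=1$ for $t\geq 2$; $f_2(2)=3$; $f_2(3)=4$; $f_2(4)=6$; $f_2(s)=s$ for $s\geq 5$; $f_p(2)=2p-2$ and $f_p(3)=2p^2-3p+4$ for $p\geq 3$; and $f_p(m)=f_{p-1}(m)+2g_{p-1}(m-1)+3m-6$ for $p\geq 3$, $m\geq 4$.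
   Context: $\chi(G)$ is the chromatic number and $\omega(G)$ the clique number of $G$. $pK_2$ is the disjoint union of $p$ edges; $K_5-e$ is the complete graph on five vertices minus one edge. A graph is $\mathcal{F}$-free if it has no induced subgraph isomorphic to a member of $\mathcal{F}$. -}

module Defs where

open import Data.Nat using (ℕ; zero; suc; _+_; _*_; _∸_)
open import Data.Bool using (Bool; true; false; _∧_; not)
open import Data.Fin using (Fin; toℕ)
open import Data.Fin.Properties using (_≟_)
open import Data.Product using (Σ; _×_; _,_; ∃)
open import Relation.Nullary using (¬_)
open import Relation.Nullary.Decidable using (⌊_⌋)
open import Relation.Binary.PropositionalEquality using (_≡_; _≢_)
open import Function.Definitions using (Injective)

record Graph (V : Set) : Set where
  field
    adj    : V → V → Bool
    sym    : ∀ x y → adj x y ≡ adj y x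
    irrefl : ∀ x → adj x x ≡ false
open Graph public

InducedSubgraph : {W V : Set} → Graph W → Graph V → Set
InducedSubgraph {W} {V} H G =
  Σ (W → V) λ φ → Injective _≡_ _≡_ φ × (∀ x y → adj H x y ≡ adj G (φ x) (φ y))

Free : {W V : Set} → Graph W → Graph V → Set
Free F G = ¬ InducedSubgraph F G

pK2 : (p : ℕ) → Graph (Fin p × Fin 2)
pK2 p = record { adj = a ; sym = s ; irrefl = ir }
  where
  a : Fin p × Fin 2 → Fin p × Fin 2 → Bool
  a (i , x) (j , y) = ⌊ i ≟ j ⌋ ∧ not ⌊ x ≟ y ⌋
  s : ∀ u v → a u v ≡ a v u
  s (i , Fin.zero) (j , Fin.zero) with i ≟ j | j ≟ i
  ... | Relation.Nullary.yes _ | Relation.Nullary.yes _ = _≡_.refl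
  ... | Relation.Nullary.yes e | Relation.Nullary.no n = Data.Empty.⊥-elim (n (Relation.Binary.PropositionalEquality.sym e))
    where import Data.Empty
  ... | Relation.Nullary.no n | Relation.Nullary.yes e = Data.Empty.⊥-elim (n (Relation.Binary.PropositionalEquality.sym e))
    where import Data.Empty
  ... | Relation.Nullary.no _ | Relation.Nullary.no _ = _≡_.refl
  s (i , Fin.zero) (j , Fin.suc Fin.zero) with i ≟ j | j ≟ i
  ... | Relation.Nullary.yes _ | Relation.Nullary.yes _ = _≡_.refl
  ... | Relation.Nullary.yes e | Relation.Nullary.no n = Data.Empty.⊥-elim (n (Relation.Binary.PropositionalEquality.sym e))
    where import Data.Empty
  ... | Relation.Nullary.no n | Relation.Nullary.yes e = Data.Empty.⊥-elim (n (Relation.Binary.PropositionalEquality.sym e))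
    where import Data.Empty
  ... | Relation.Nullary.no _ | Relation.Nullary.no _ = _≡_.refl
  s (i , Fin.suc Fin.zero) (j , Fin.zero) with i ≟ j | j ≟ i
  ... | Relation.Nullary.yes _ | Relation.Nullary.yes _ = _≡_.refl
  ... | Relation.Nullary.yes e | Relation.Nullary.no n = Data.Empty.⊥-elim (n (Relation.Binary.PropositionalEquality.sym e))
    where import Data.Empty
  ... | Relation.Nullary.no n | Relation.Nullary.yes e = Data.Empty.⊥-elim (n (Relation.Binary.PropositionalEquality.sym e))
    where import Data.Empty
  ... | Relation.Nullary.no _ | Relation.Nullary.no _ = _≡_.refl
  s (i , Fin.suc Fin.zero) (j , Fin.suc Fin.zero) with i ≟ j | j ≟ i
  ... | Relation.Nullary.yes _ | Relation.Nullary.yes _ = _≡_.refl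
  ... | Relation.Nullary.yes e | Relation.Nullary.no n = Data.Empty.⊥-elim (n (Relation.Binary.PropositionalEquality.sym e))
    where import Data.Empty
  ... | Relation.Nullary.no n | Relation.Nullary.yes e = Data.Empty.⊥-elim (n (Relation.Binary.PropositionalEquality.sym e))
    where import Data.Empty
  ... | Relation.Nullary.no _ | Relation.Nullary.no _ = _≡_.refl
  ir : ∀ u → a u u ≡ false
  ir (i , Fin.zero) with i ≟ i
  ... | Relation.Nullary.yes _ = _≡_.refl
  ... | Relation.Nullary.no _ = _≡_.refl
  ir (i , Fin.suc Fin.zero) with i ≟ i
  ... | Relation.Nullary.yes _ = _≡_.refl
  ... | Relation.Nullary.no _ = _≡_.refl

K5-e-adj : Fin 5 → Fin 5 → Bool
K5-e-adj Fin.zero Fin.zero = false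
K5-e-adj Fin.zero (Fin.suc Fin.zero) = false
K5-e-adj Fin.zero (Fin.suc (Fin.suc Fin.zero)) = true
K5-e-adj Fin.zero (Fin.suc (Fin.suc (Fin.suc Fin.zero))) = true
K5-e-adj Fin.zero (Fin.suc (Fin.suc (Fin.suc (Fin.suc Fin.zero)))) = true
K5-e-adj (Fin.suc Fin.zero) Fin.zero = false
K5-e-adj (Fin.suc Fin.zero) (Fin.suc Fin.zero) = false
K5-e-adj (Fin.suc Fin.zero) (Fin.suc (Fin.suc Fin.zero)) = true
K5-e-adj (Fin.suc Fin.zero) (Fin.suc (Fin.suc (Fin.suc Fin.zero))) = true
K5-e-adj (Fin.suc Fin.zero) (Fin.suc (Fin.suc (Fin.suc (Fin.suc Fin.zero)))) = true
K5-e-adj (Fin.suc (Fin.suc Fin.zero)) Fin.zero = true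
K5-e-adj (Fin.suc (Fin.suc Fin.zero)) (Fin.suc Fin.zero) = true
K5-e-adj (Fin.suc (Fin.suc Fin.zero)) (Fin.suc (Fin.suc Fin.zero)) = false
K5-e-adj (Fin.suc (Fin.suc Fin.zero)) (Fin.suc (Fin.suc (Fin.suc Fin.zero))) = true
K5-e-adj (Fin.suc (Fin.suc Fin.zero)) (Fin.suc (Fin.suc (Fin.suc (Fin.suc Fin.zero)))) = true
K5-e-adj (Fin.suc (Fin.suc (Fin.suc Fin.zero))) Fin.zero = true
K5-e-adj (Fin.suc (Fin.suc (Fin.suc Fin.zero))) (Fin.suc Fin.zero) = true
K5-e-adj (Fin.suc (Fin.suc (Fin.suc Fin.zero))) (Fin.suc (Fin.suc Fin.zero)) = true
K5-e-adj (Fin.suc (Fin.suc (Fin.suc Fin.zero))) (Fin.suc (Fin.suc (Fin.suc Fin.zero))) = false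
K5-e-adj (Fin.suc (Fin.suc (Fin.suc Fin.zero))) (Fin.suc (Fin.suc (Fin.suc (Fin.suc Fin.zero)))) = true
K5-e-adj (Fin.suc (Fin.suc (Fin.suc (Fin.suc Fin.zero)))) Fin.zero = true
K5-e-adj (Fin.suc (Fin.suc (Fin.suc (Fin.suc Fin.zero)))) (Fin.suc Fin.zero) = true
K5-e-adj (Fin.suc (Fin.suc (Fin.suc (Fin.suc Fin.zero)))) (Fin.suc (Fin.suc Fin.zero)) = true
K5-e-adj (Fin.suc (Fin.suc (Fin.suc (Fin.suc Fin.zero)))) (Fin.suc (Fin.suc (Fin.suc Fin.zero))) = true
K5-e-adj (Fin.suc (Fin.suc (Fin.suc (Fin.suc Fin.zero)))) (Fin.suc (Fin.suc (Fin.suc (Fin.suc Fin.zero)))) = false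

K5-e : Graph (Fin 5)
K5-e = record { adj = K5-e-adj ; sym = s ; irrefl = ir }
  where
  s : ∀ x y → K5-e-adj x y ≡ K5-e-adj y x
  s Fin.zero Fin.zero = _≡_.refl
  s Fin.zero (Fin.suc Fin.zero) = _≡_.refl
  s Fin.zero (Fin.suc (Fin.suc Fin.zero)) = _≡_.refl
  s Fin.zero (Fin.suc (Fin.suc (Fin.suc Fin.zero))) = _≡_.refl
  s Fin.zero (Fin.suc (Fin.suc (Fin.suc (Fin.suc Fin.zero)))) = _≡_.refl
  s (Fin.suc Fin.zero) Fin.zero = _≡_.refl
  s (Fin.suc Fin.zero) (Fin.suc Fin.zero) = _≡_.refl
  s (Fin.suc Fin.zero) (Fin.suc (Fin.suc Fin.zero)) = _≡_.refl
  s (Fin.suc Fin.zero) (Fin.suc (Fin.suc (Fin.suc Fin.zero))) = _≡_.refl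
  s (Fin.suc Fin.zero) (Fin.suc (Fin.suc (Fin.suc (Fin.suc Fin.zero)))) = _≡_.refl
  s (Fin.suc (Fin.suc Fin.zero)) Fin.zero = _≡_.refl
  s (Fin.suc (Fin.suc Fin.zero)) (Fin.suc Fin.zero) = _≡_.refl
  s (Fin.suc (Fin.suc Fin.zero)) (Fin.suc (Fin.suc Fin.zero)) = _≡_.refl
  s (Fin.suc (Fin.suc Fin.zero)) (Fin.suc (Fin.suc (Fin.suc Fin.zero))) = _≡_.refl
  s (Fin.suc (Fin.suc Fin.zero)) (Fin.suc (Fin.suc (Fin.suc (Fin.suc Fin.zero)))) = _≡_.refl
  s (Fin.suc (Fin.suc (Fin.suc Fin.zero))) Fin.zero = _≡_.refl
  s (Fin.suc (Fin.suc (Fin.suc Fin.zero))) (Fin.suc Fin.zero) = _≡_.refl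
  s (Fin.suc (Fin.suc (Fin.suc Fin.zero))) (Fin.suc (Fin.suc Fin.zero)) = _≡_.refl
  s (Fin.suc (Fin.suc (Fin.suc Fin.zero))) (Fin.suc (Fin.suc (Fin.suc Fin.zero))) = _≡_.refl
  s (Fin.suc (Fin.suc (Fin.suc Fin.zero))) (Fin.suc (Fin.suc (Fin.suc (Fin.suc Fin.zero)))) = _≡_.refl
  s (Fin.suc (Fin.suc (Fin.suc (Fin.suc Fin.zero)))) Fin.zero = _≡_.refl
  s (Fin.suc (Fin.suc (Fin.suc (Fin.suc Fin.zero)))) (Fin.suc Fin.zero) = _≡_.refl
  s (Fin.suc (Fin.suc (Fin.suc (Fin.suc Fin.zero)))) (Fin.suc (Fin.suc Fin.zero)) = _≡_.refl
  s (Fin.suc (Fin.suc (Fin.suc (Fin.suc Fin.zero)))) (Fin.suc (Fin.suc (Fin.suc Fin.zero))) = _≡_.refl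
  s (Fin.suc (Fin.suc (Fin.suc (Fin.suc Fin.zero)))) (Fin.suc (Fin.suc (Fin.suc (Fin.suc Fin.zero)))) = _≡_.refl
  ir : ∀ x → K5-e-adj x x ≡ false
  ir Fin.zero = _≡_.refl
  ir (Fin.suc Fin.zero) = _≡_.refl
  ir (Fin.suc (Fin.suc Fin.zero)) = _≡_.refl
  ir (Fin.suc (Fin.suc (Fin.suc Fin.zero))) = _≡_.refl
  ir (Fin.suc (Fin.suc (Fin.suc (Fin.suc Fin.zero)))) = _≡_.refl

HasClique : {V : Set} → Graph V → ℕ → Set
HasClique {V} G k =
  Σ (Fin k → V) λ c → Injective _≡_ _≡_ c × (∀ i j → i ≢ j → adj G (c i) (c j) ≡ true)

IsCliqueNumber : {V : Set} → Graph V → ℕ → Set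
IsCliqueNumber G w = HasClique G w × ¬ HasClique G (suc w)

-- proper k-colouring exists, i.e. χ(G) ≤ k
Colourable : {V : Set} → Graph V → ℕ → Set
Colourable {V} G k =
  Σ (V → Fin k) λ c → ∀ x y → adj G x y ≡ true → c x ≢ c y

-- g p m (meaningful for p ≥ 2, m ≥ 1; other values are junk 0)
g : ℕ → ℕ → ℕ
g 0 _ = 0
g 1 _ = 0
g (suc (suc p)) 0 = 0
g (suc (suc p)) 1 = 1
g 2 2 = 3
g 2 (suc (suc (suc k))) = suc (suc (suc k))
g (suc (suc (suc p))) 2 = 2 * (suc (suc (suc p))) ∸ 2
g (suc (suc (suc p))) (suc (suc (suc k))) =
  g (suc (suc p)) (suc (suc (suc k))) + (2 * (suc (suc (suc k))) ∸ 2)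

-- f p m (meaningful for p ≥ 2, m ≥ 1; f p 0 = 0, the chromatic number of the empty graph)
f : ℕ → ℕ → ℕ
f 0 _ = 0
f 1 _ = 0
f (suc (suc p)) 0 = 0
f (suc (suc p)) 1 = 1
f 2 2 = 3
f 2 3 = 4
f 2 4 = 6
f 2 (suc (suc (suc (suc (suc s))))) = suc (suc (suc (suc (suc s))))
f (suc (suc (suc p))) 2 = 2 * (suc (suc (suc p))) ∸ 2
f (suc (suc (suc p))) 3 =
  (2 * (suc (suc (suc p))) * (suc (suc (suc p))) + 4) ∸ 3 * (suc (suc (suc p)))
f (suc (suc (suc p))) (suc (suc (suc (suc k)))) =
  f (suc (suc p)) (suc (suc (suc (suc k))))
  + 2 * g (suc (suc p)) (suc (suc (suc k)))
  + (3 * (suc (suc (suc (suc k)))) ∸ 6)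

{-# OPTIONS --safe #-}
module Submission where

-- Every bound is proved under the hypothesis ω(G) ≤ m, not ω(G) = m, because f is not monotone (f 2 5 = 5 < 6 = f 2 4).
--
-- Let G contain a triangle abc. The common neighbourhoods of ab, ac and bc are disjoint unions of cliques, since G has no
-- K₅ − e, and take m − 2 colours each. The remaining neighbours of a are far from the edge bc, hence (p − 1)K₂-free, and
-- diamond-free; the same holds for b and ac. The vertices far from ab are (p − 1)K₂-free. This is the recursion of f; the
-- recursion of g comes in the same way from an edge. What remains are the case p = 2 and the triangle-free 3K₂-free graphs.
-- If p = 2 and there is a large clique K, then the vertices outside K are independent and each of them misses a vertex of K.
--
-- The other cases, among them the theorem of Gaspers and Huang that (2K₂, K₄)-free graphs are 4-colourable, are settled by
-- certificates: lists of graphs H₁, …, Hᵣ such that every graph which contains Hᵢ but none of Hᵢ₊₁, …, Hᵣ is colourable. The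
-- vertices are classified by their adjacency to Hᵢ. A class, or an edge between two classes, cannot occur if it would create a
-- forbidden graph or a later Hⱼ; then it suffices to assign the colours to the classes. Moreover, a vertex may be removed
-- if its neighbours are all neighbours of another vertex.

open import Defs
open import Data.Bool as Bool using (Bool; true; false; not; _∧_)
open import Data.Bool.Properties using (not-¬; ¬-not)
open import Data.Empty using (⊥; ⊥-elim)
open import Data.Fin as Fin
  using (Fin; zero; suc; fromℕ<; toℕ; inject≤; punchIn; punchOut; finToFun; funToFin; join; splitAt)
open import Data.Fin.Properties
  using (any?; all?; ¬∀⟶∃¬; toℕ<n; toℕ-injective; splitAt-join; join-splitAt; inject≤-injective; fromℕ<-injective;
         punchIn-punchOut; punchIn-injective; finToFun-funToFin)
open import Data.List
  using (List; []; _∷_; _∷ʳ_; _++_; map; concat; concatMap; cartesianProductWith; length; replicate; upTo;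
         applyUpTo; filter; take; drop; zip; lookup; allFin)
open import Data.List.Membership.Propositional using (_∈_; lose)
open import Data.List.Membership.Propositional.Properties
  using (∈-++⁺ˡ; ∈-++⁺ʳ; ∈-map⁺; ∈-filter⁺; ∈-lookup; ∈-allFin; ∈-applyUpTo⁺; ∈-cartesianProductWith⁺; ∈-concatMap⁺)
open import Data.List.Membership.Setoid.Properties using (index-injective)
open import Data.List.Properties using (applyUpTo-∷ʳ; filter-≐; length-tabulate)
open import Data.List.Relation.Binary.Pointwise as Pointwise using (Pointwise; []; _∷_)
open import Data.List.Relation.Unary.All as All using (All; []; _∷_)
import Data.List.Relation.Unary.All.Properties as All
open import Data.List.Relation.Unary.AllPairs as AllPairs using (AllPairs; []; _∷_)
open import Data.List.Relation.Unary.Any as Any using (Any; here; there)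
import Data.List.Relation.Unary.Any.Properties as Any
open import Data.List.Relation.Unary.Unique.Propositional using (Unique)
import Data.List.Relation.Unary.Unique.Propositional.Properties as Unique
open import Data.Nat as ℕ using (ℕ; zero; suc; _+_; _*_; _∸_; _⊓_; _<_; _≤_; _/_; _%_)
open import Data.List.Membership.DecPropositional ℕ._≟_ using (_∈?_)
import Data.Nat.Properties as ℕ
open import Data.Nat.Tactic.RingSolver using (solve-∀)
open import Data.Product as Product using (Σ; ∃; _×_; _,_; proj₁; proj₂; uncurry)
open import Data.Sum as Sum using (_⊎_; inj₁; inj₂; [_,_]′)
open import Data.Sum.Properties using (inj₁-injective; inj₂-injective)
open import Data.Unit using (⊤; tt)
import Data.Vec.Functional as Vector
open import Function using (_∘_; case_of_)
open import Function.Definitions using (Injective)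
open import Relation.Binary.Definitions using (Symmetric)
open import Relation.Binary.PropositionalEquality
  using (_≡_; _≢_; _≗_; refl; ≢-sym; cong; cong₂; setoid; subst; subst₂; trans; module ≡-Reasoning)
  renaming (sym to ≡-sym)
open import Relation.Nullary using (¬_; Dec; does; yes; no; ¬?; contradiction)
open import Relation.Nullary.Decidable using (map′; decidable-stable; from-yes; isYes≗does; _×-dec_; _⊎-dec_; _→-dec_)
open import Relation.Unary using (Decidable)
open import Relation.Unary.Properties using (∁?)

private variable
  A V W : Set
  R : A → A → Set
  k l m n p : ℕ

-- Lists

allPairs-lookup : ∀ {xs : List A} {x y} → AllPairs R xs → x ∈ xs → y ∈ xs → x ≡ y ⊎ R x y ⊎ R y x
allPairs-lookup (Rx ∷ _)   (here refl) (here refl) = inj₁ refl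
allPairs-lookup (Rx ∷ _)   (here refl) (there y∈)  = inj₂ (inj₁ (All.lookup Rx y∈))
allPairs-lookup (Ry ∷ _)   (there x∈)  (here refl) = inj₂ (inj₂ (All.lookup Ry x∈))
allPairs-lookup (_  ∷ Rxs) (there x∈)  (there y∈)  = allPairs-lookup Rxs x∈ y∈

allPairs-lookup-index : ∀ {xs : List A} → Symmetric R → AllPairs R xs → ∀ i j → i ≢ j → R (lookup xs i) (lookup xs j)
allPairs-lookup-index R-sym (Rx ∷ _)  zero    zero    i≢j = contradiction refl i≢j
allPairs-lookup-index R-sym (Rx ∷ _)  zero    (suc j) i≢j = All.lookup Rx (∈-lookup j)
allPairs-lookup-index R-sym (Rx ∷ _)  (suc i) zero    i≢j = R-sym (All.lookup Rx (∈-lookup i))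
allPairs-lookup-index R-sym (_ ∷ Rxs) (suc i) (suc j) i≢j = allPairs-lookup-index R-sym Rxs i j (i≢j ∘ cong suc)

lookup-injective : {xs : List A} → Unique xs → Injective _≡_ _≡_ (lookup xs)
lookup-injective unique {i} {j} xsᵢ≡xsⱼ with i Fin.≟ j
... | yes i≡j = i≡j
... | no i≢j  = contradiction xsᵢ≡xsⱼ (allPairs-lookup-index ≢-sym unique i j i≢j)

length-filter-∁ : {P : A → Set} (P? : Decidable P) → ∀ xs →
                  length (filter P? xs) + length (filter (∁? P?) xs) ≡ length xs
length-filter-∁ P? []       = refl
length-filter-∁ P? (x ∷ xs) with P? x
... | yes _ = cong suc (length-filter-∁ P? xs)
... | no _  = trans (ℕ.+-suc _ _) (cong suc (length-filter-∁ P? xs))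

-- Graphs and colourings

module Adjacency (G : Graph V) where

  infix 4 _~_ _≁_ _~?_

  _~_ _≁_ : V → V → Set
  x ~ y = adj G x y ≡ true
  x ≁ y = adj G x y ≡ false

  _~?_ : ∀ x y → Dec (x ~ y)
  x ~? y = adj G x y Bool.≟ true

  ~-sym : ∀ {x y} → x ~ y → y ~ x
  ~-sym {x} {y} x~y = trans (Graph.sym G y x) x~y

  ≁-sym : ∀ {x y} → x ≁ y → y ≁ x
  ≁-sym {x} {y} x≁y = trans (Graph.sym G y x) x≁y

  ≁⇒¬~ : ∀ {x y} → x ≁ y → ¬ x ~ y
  ≁⇒¬~ = not-¬

  ¬~⇒≁ : ∀ {x y} → ¬ x ~ y → x ≁ y
  ¬~⇒≁ = ¬-not

  ~⇒≢ : ∀ {x y} → x ~ y → x ≢ y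
  ~⇒≢ {x} x~x refl = ≁⇒¬~ (irrefl G x) x~x

Homomorphism : Graph V → Graph W → (V → W) → Set
Homomorphism G H h = ∀ x y → x G.~ y → h x H.~ h y
  where
  module G = Adjacency G
  module H = Adjacency H

restrict : Graph V → (W → V) → Graph W
restrict G ι = record
  { adj    = λ x y → adj G (ι x) (ι y)
  ; sym    = λ x y → Graph.sym G (ι x) (ι y)
  ; irrefl = λ x → irrefl G (ι x)
  }

Proper : Graph V → (V → Fin k) → Set
Proper G c = ∀ x y → adj G x y ≡ true → c x ≢ c y

colourable-hom : (G : Graph V) (H : Graph W) {h : V → W} → Homomorphism G H h → Colourable H k → Colourable G k
colourable-hom G H {h} h-hom (c , c-proper) = c ∘ h , λ x y x~y → c-proper (h x) (h y) (h-hom x y x~y)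

colourable-mono : (G : Graph V) → k ≤ l → Colourable G k → Colourable G l
colourable-mono G k≤l (c , c-proper) =
  (λ x → inject≤ (c x) k≤l) , λ x y x~y → c-proper x y x~y ∘ inject≤-injective k≤l k≤l _ _

any-function? : {P : (Fin m → Fin n) → Set} → (∀ {f g} → f ≗ g → P f → P g) → Decidable P → Dec (∃ P)
any-function? P-resp P? = map′
  (λ (i , p) → finToFun i , p)
  (λ (f , p) → funToFin f , P-resp (≡-sym ∘ finToFun-funToFin f) p)
  (any? (P? ∘ finToFun))

colourable? : (G : Graph (Fin n)) → ∀ k → Dec (Colourable G k)
colourable? G k = any-function?
  (λ f≗g f-proper x y x~y gx≡gy → f-proper x y x~y (trans (f≗g x) (trans gx≡gy (≡-sym (f≗g y)))))
  (λ c → all? λ x → all? λ y → (x ~? y) →-dec ¬? (c x Fin.≟ c y))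
  where open Adjacency G

module _ (G : Graph (Fin (suc n))) {u v : Fin (suc n)} where

  open Adjacency G

  -- The vertex u may receive the colour of v.
  dominated-vertex-removable : u ≢ v → (∀ w → w ~ u → w ~ v) → Colourable (restrict G (punchIn u)) k → Colourable G k
  dominated-vertex-removable u≢v N[u]⊆N[v] = colourable-hom G (restrict G (punchIn u)) retraction-hom
    where
    retraction : Fin (suc n) → Fin n
    retraction x with u Fin.≟ x
    ... | yes _  = punchOut u≢v
    ... | no u≢x = punchOut u≢x
    punchOut-~ : ∀ {x y} (u≢x : u ≢ x) (u≢y : u ≢ y) → x ~ y → punchIn u (punchOut u≢x) ~ punchIn u (punchOut u≢y)
    punchOut-~ u≢x u≢y = subst₂ _~_ (≡-sym (punchIn-punchOut u≢x)) (≡-sym (punchIn-punchOut u≢y))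
    retraction-hom : Homomorphism G (restrict G (punchIn u)) retraction
    retraction-hom x y x~y with u Fin.≟ x | u Fin.≟ y
    ... | yes refl | yes refl = contradiction refl (~⇒≢ x~y)
    ... | yes refl | no u≢y   = punchOut-~ u≢v u≢y (~-sym (N[u]⊆N[v] y (~-sym x~y)))
    ... | no u≢x   | yes refl = punchOut-~ u≢x u≢v (N[u]⊆N[v] x x~y)
    ... | no u≢x   | no u≢y   = punchOut-~ u≢x u≢y x~y

infix 6 _↾_

_↾_ : Graph V → (S : V → Set) → Graph (Σ V S)
G ↾ S = restrict G proj₁

colourable-cover : (G : Graph V) {S : V → Set} → (∀ x → S x) → Colourable (G ↾ S) k → Colourable G k
colourable-cover G {S} cover = colourable-hom G (G ↾ S) {λ x → x , cover x} λ _ _ x~y → x~y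

module _ (G : Graph V) {S S′ : V → Set} where

  colourable-⊆ : (∀ {x} → S x → S′ x) → Colourable (G ↾ S′) k → Colourable (G ↾ S) k
  colourable-⊆ S⊆S′ = colourable-hom (G ↾ S) (G ↾ S′) {λ (x , x∈S) → x , S⊆S′ x∈S} λ _ _ x~y → x~y

  colourable-∪ : Colourable (G ↾ S) k → Colourable (G ↾ S′) l → Colourable (G ↾ (λ x → S x ⊎ S′ x)) (k + l)
  colourable-∪ {k} {l} (c , c-proper) (c′ , c′-proper) =
    join k l ∘ combined , λ x y x~y → combined-proper x y x~y ∘ join-injective
    where
    combined : Σ V (λ x → S x ⊎ S′ x) → Fin k ⊎ Fin l
    combined (x , inj₁ x∈S)  = inj₁ (c (x , x∈S))
    combined (x , inj₂ x∈S′) = inj₂ (c′ (x , x∈S′))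
    join-injective : ∀ {i j} → join k l i ≡ join k l j → i ≡ j
    join-injective {i} {j} q = trans (≡-sym (splitAt-join k l i)) (trans (cong (splitAt k) q) (splitAt-join k l j))
    combined-proper : ∀ x y → adj G (proj₁ x) (proj₁ y) ≡ true → combined x ≢ combined y
    combined-proper (x , inj₁ x∈S)  (y , inj₁ y∈S)  x~y = c-proper (x , x∈S) (y , y∈S) x~y ∘ inj₁-injective
    combined-proper (x , inj₁ _)    (y , inj₂ _)    x~y = λ ()
    combined-proper (x , inj₂ _)    (y , inj₁ _)    x~y = λ ()
    combined-proper (x , inj₂ x∈S′) (y , inj₂ y∈S′) x~y = c′-proper (x , x∈S′) (y , y∈S′) x~y ∘ inj₂-injective

colourable-subset : (G : Graph (Fin n)) {S : Fin n → Set} → Decidable S →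
  (∀ {m} (ι : Fin m → Fin n) → Injective _≡_ _≡_ ι → (∀ i → S (ι i)) → Colourable (restrict G ι) k) →
  Colourable (G ↾ S) k
colourable-subset {n} G {S} S? colour = colourable-hom (G ↾ S) (restrict G (lookup members)) {position} position-hom
  (colour (lookup members) (lookup-injective (Unique.filter⁺ S? (Unique.allFin⁺ n)))
    (λ i → All.lookup (All.all-filter S? (allFin n)) (∈-lookup i)))
  where
  members : List (Fin n)
  members = filter S? (allFin n)
  member : ∀ {x} → S x → x ∈ members
  member {x} = ∈-filter⁺ S? (∈-allFin x)
  position : Σ (Fin n) S → Fin (length members)
  position (x , x∈S) = Any.index (member x∈S)
  position-hom : Homomorphism (G ↾ S) (restrict G (lookup members)) position
  position-hom (x , x∈S) (y , y∈S) =
    subst₂ (Adjacency._~_ G) (Any.lookup-index (member x∈S)) (Any.lookup-index (member y∈S))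

-- Cliques, near-cliques and induced matchings

module _ (G : Graph V) where

  open Adjacency G

  IsClique : {I : Set} → (I → V) → Set
  IsClique c = ∀ i j → i ≢ j → c i ~ c j

  record NearClique (m : ℕ) : Set where
    constructor mkNearClique
    field
      {a b}    : V
      a≢b      : a ≢ b
      a≁b      : a ≁ b
      {base}   : Fin m → V
      isClique : IsClique base
      a~base   : ∀ i → a ~ base i
      b~base   : ∀ i → b ~ base i

  Far : V → V → V → Set
  Far u v x = u ≁ x × v ≁ x

  isClique-injective : {c : Fin m → V} → IsClique c → Injective _≡_ _≡_ c
  isClique-injective isClique {i} {j} cᵢ≡cⱼ with i Fin.≟ j
  ... | yes i≡j = i≡j
  ... | no i≢j  = contradiction cᵢ≡cⱼ (~⇒≢ (isClique i j i≢j))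

  isClique⇒hasClique : {c : Fin m → V} → IsClique c → HasClique G m
  isClique⇒hasClique {c = c} isClique = c , isClique-injective isClique , isClique

  isClique-∘ : {I J : Set} {c : I → V} {h : J → I} → Injective _≡_ _≡_ h → IsClique c → IsClique (c ∘ h)
  isClique-∘ h-injective isClique i j i≢j = isClique _ _ (i≢j ∘ h-injective)

  isClique-⊎ : {I J : Set} {c : I → V} {d : J → V} → IsClique c → IsClique d → (∀ i j → c i ~ d j) → IsClique [ c , d ]′
  isClique-⊎ c-clique d-clique c~d (inj₁ i) (inj₁ j) i≢j = c-clique i j (i≢j ∘ cong inj₁)
  isClique-⊎ c-clique d-clique c~d (inj₁ i) (inj₂ j) _   = c~d i j
  isClique-⊎ c-clique d-clique c~d (inj₂ i) (inj₁ j) _   = ~-sym (c~d j i)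
  isClique-⊎ c-clique d-clique c~d (inj₂ i) (inj₂ j) i≢j = d-clique i j (i≢j ∘ cong inj₂)

  isClique-∷ : ∀ {x} {c : Fin m → V} → (∀ i → x ~ c i) → IsClique c → IsClique (x Vector.∷ c)
  isClique-∷ x~c isClique zero    zero    0≢0 = contradiction refl 0≢0
  isClique-∷ x~c isClique zero    (suc j) _   = x~c j
  isClique-∷ x~c isClique (suc i) zero    _   = ~-sym (x~c i)
  isClique-∷ x~c isClique (suc i) (suc j) i≢j = isClique i j (i≢j ∘ cong suc)

  vertex-isClique : ∀ u → IsClique (u Vector.∷ Vector.[])
  vertex-isClique u = isClique-∷ (λ ()) λ ()

  edge-isClique : ∀ {u v} → u ~ v → IsClique (u Vector.∷ v Vector.∷ Vector.[])
  edge-isClique {v = v} u~v = isClique-∷ (λ { zero → u~v }) (vertex-isClique v)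

  join-cliques : {c : Fin m → V} {d : Fin n → V} → IsClique c → IsClique d → (∀ i j → c i ~ d j) → HasClique G (m + n)
  join-cliques {m} {n} c-clique d-clique c~d =
    isClique⇒hasClique (isClique-∘ splitAt-injective (isClique-⊎ c-clique d-clique c~d))
    where
    splitAt-injective : Injective _≡_ _≡_ (splitAt m {n})
    splitAt-injective {i} {j} q = trans (≡-sym (join-splitAt m n i)) (trans (cong (join m n) q) (join-splitAt m n j))

  hasClique-≤ : m ≤ n → HasClique G n → HasClique G m
  hasClique-≤ m≤n (c , _ , isClique) =
    isClique⇒hasClique (isClique-∘ (inject≤-injective m≤n m≤n _ _) isClique)

  clique-free⇒near-clique-free : ¬ HasClique G (suc m) → ¬ NearClique m
  clique-free⇒near-clique-free clique-free (mkNearClique _ _ isClique a~base _) =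
    clique-free (isClique⇒hasClique (isClique-∷ a~base isClique))

  extend-nearClique : ∀ {x} (N : NearClique m) → let open NearClique N in
                      x ~ a → x ~ b → (∀ i → x ~ base i) → NearClique (suc m)
  extend-nearClique (mkNearClique a≢b a≁b isClique a~base b~base) x~a x~b x~base = mkNearClique a≢b a≁b
    (isClique-∷ x~base isClique)
    (λ { zero → ~-sym x~a ; (suc i) → a~base i })
    (λ { zero → ~-sym x~b ; (suc i) → b~base i })

  empty-matching : InducedSubgraph (pK2 0) G
  empty-matching = (λ { (() , _) }) , (λ { {() , _} }) , λ { (() , _) }

  extend-matching : ∀ {u v} → u ~ v → ((ψ , _) : InducedSubgraph (pK2 p) G) → (∀ s → Far u v (ψ s)) →
                    InducedSubgraph (pK2 (suc p)) G
  extend-matching {p} {u} {v} u~v (ψ , ψ-injective , ψ-adj) far = φ , (λ {s} {t} → φ-injective s t) , φ-adj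
    where
    end : Fin 2 → V
    end = u Vector.∷ v Vector.∷ Vector.[]
    end≁ψ : ∀ x s → end x ≁ ψ s
    end≁ψ zero       s = proj₁ (far s)
    end≁ψ (suc zero) s = proj₂ (far s)
    end≢ψ : ∀ x s → end x ≢ ψ s
    end≢ψ zero       s refl = ≁⇒¬~ (end≁ψ (suc zero) s) (~-sym u~v)
    end≢ψ (suc zero) s refl = ≁⇒¬~ (end≁ψ zero s) u~v
    φ : Fin (suc p) × Fin 2 → V
    φ (zero  , x) = end x
    φ (suc i , x) = ψ (i , x)
    φ-injective : ∀ s t → φ s ≡ φ t → s ≡ t
    φ-injective (zero  , x) (zero  , y) q = cong (zero ,_) (isClique-injective (edge-isClique u~v) q)
    φ-injective (zero  , x) (suc j , y) q = contradiction q (end≢ψ x (j , y))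
    φ-injective (suc i , x) (zero  , y) q = contradiction (≡-sym q) (end≢ψ y (i , x))
    φ-injective (suc i , x) (suc j , y) q = cong (Product.map₁ suc) (ψ-injective q)
    φ-adj : ∀ s t → adj (pK2 (suc p)) s t ≡ adj G (φ s) (φ t)
    φ-adj (zero  , x) (zero  , y) with x Fin.≟ y
    ... | yes refl = ≡-sym (irrefl G (end x))
    ... | no x≢y   = ≡-sym (edge-isClique u~v x y x≢y)
    φ-adj (zero  , x) (suc j , y) = ≡-sym (end≁ψ x (j , y))
    φ-adj (suc i , x) (zero  , y) = ≡-sym (≁-sym (end≁ψ y (i , x)))
    φ-adj (suc i , x) (suc j , y) = trans
      (cong (_∧ _) (trans (isYes≗does (suc i Fin.≟ suc j)) (≡-sym (isYes≗does (i Fin.≟ j)))))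
      (ψ-adj (i , x) (j , y))

  two-edges : ∀ {u v x y} → u ~ v → x ~ y → Far u v x → Far u v y → InducedSubgraph (pK2 2) G
  two-edges u~v x~y far-x far-y = extend-matching u~v (extend-matching x~y empty-matching λ { (() , _) }) λ
    { (zero , zero) → far-x ; (zero , suc zero) → far-y }

module _ (G : Graph V) (ι : W → V) where

  open Adjacency G

  hasClique-restrict : HasClique (restrict G ι) m → HasClique G m
  hasClique-restrict (_ , _ , isClique) = isClique⇒hasClique G isClique

  nearClique-restrict : Injective _≡_ _≡_ ι → NearClique (restrict G ι) m → NearClique G m
  nearClique-restrict ι-injective (mkNearClique a≢b a≁b isClique a~base b~base) =
    mkNearClique (a≢b ∘ ι-injective) a≁b isClique a~base b~base

  far-matching-free : ∀ {u v} → u ~ v → Injective _≡_ _≡_ ι → (∀ x → Far G u v (ι x)) →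
                     Free (pK2 (suc p)) G → Free (pK2 p) (restrict G ι)
  far-matching-free u~v ι-injective far free (ψ , ψ-injective , ψ-adj) =
    free (extend-matching G u~v (ι ∘ ψ , ψ-injective ∘ ι-injective , ψ-adj) (far ∘ ψ))

module _ (G : Graph (Fin n)) where

  open Adjacency G

  hasClique? : ∀ m → Dec (HasClique G m)
  hasClique? m = map′ (λ (c , isClique) → isClique⇒hasClique G isClique) (λ (c , _ , isClique) → c , isClique)
    (any-function?
      (λ f≗g f-clique i j i≢j → subst₂ _~_ (f≗g i) (f≗g j) (f-clique i j i≢j))
      (λ c → all? λ i → all? λ j → ¬? (i Fin.≟ j) →-dec (c i ~? c j)))

  edge? : (∃ λ u → ∃ λ v → u ~ v) ⊎ ¬ HasClique G 2
  edge? with hasClique? 2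
  ... | yes (c , _ , isClique) = inj₁ (c zero , c (suc zero) , isClique _ _ λ ())
  ... | no edgeless            = inj₂ edgeless

  triangle? : (∃ λ a → ∃ λ b → ∃ λ c → a ~ b × a ~ c × b ~ c) ⊎ ¬ HasClique G 3
  triangle? with hasClique? 3
  ... | yes (c , _ , isClique) = inj₁ (c zero , c (suc zero) , c (suc (suc zero)) ,
    isClique _ _ (λ ()) , isClique _ _ (λ ()) , isClique _ _ λ ())
  ... | no triangle-free        = inj₂ triangle-free

-- Neighbourhoods and distant parts

module _ (G : Graph (Fin n)) where

  open Adjacency G

  vertexless-colourable : ¬ HasClique G 1 → Colourable G k
  vertexless-colourable vertexless = (λ x → ⊥-elim (no-vertex x)) , λ x _ _ _ → no-vertex x
    where
    no-vertex : Fin n → ⊥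
    no-vertex x = vertexless (isClique⇒hasClique G (vertex-isClique G x))

  edgeless-colourable : ¬ HasClique G 2 → Colourable G 1
  edgeless-colourable edgeless = (λ _ → zero) , λ x y x~y _ → edgeless (isClique⇒hasClique G (edge-isClique G x~y))

  module _ (~-trans : ∀ {x y z} → x ~ y → y ~ z → x ≢ z → x ~ z) where

    infix 4 _≈_

    _≈_ : Fin n → Fin n → Set
    x ≈ y = x ≡ y ⊎ x ~ y

    ≈-sym : ∀ {x y} → x ≈ y → y ≈ x
    ≈-sym = Sum.map ≡-sym ~-sym

    ≈-trans : ∀ {x y z} → x ≈ y → y ≈ z → x ≈ z
    ≈-trans             (inj₁ refl) y≈z         = y≈z
    ≈-trans             (inj₂ x~y)  (inj₁ refl) = inj₂ x~y
    ≈-trans {x} {_} {z} (inj₂ x~y)  (inj₂ y~z) with x Fin.≟ z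
    ... | yes x≡z = inj₁ x≡z
    ... | no x≢z  = inj₂ (~-trans x~y y~z x≢z)

    cluster : Fin n → List (Fin n)
    cluster x = filter (λ y → (x Fin.≟ y) ⊎-dec (x ~? y)) (allFin n)

    ∈-cluster : ∀ x → x ∈ cluster x
    ∈-cluster x = ∈-filter⁺ _ (∈-allFin x) (inj₁ refl)

    cluster-cong : ∀ {x y} → x ≈ y → cluster x ≡ cluster y
    cluster-cong x≈y = filter-≐ _ _ (≈-trans (≈-sym x≈y) , ≈-trans x≈y) (allFin n)

    cluster-clique : ∀ x → HasClique G (length (cluster x))
    cluster-clique x = isClique⇒hasClique G λ i j i≢j → case ≈-trans (≈-sym (x≈ i)) (x≈ j) of λ
      { (inj₁ q)   → contradiction (lookup-injective (Unique.filter⁺ _ (Unique.allFin⁺ n)) q) i≢j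
      ; (inj₂ y~z) → y~z }
      where
      x≈ : ∀ i → x ≈ lookup (cluster x) i
      x≈ i = All.lookup (All.all-filter _ (allFin n)) (∈-lookup i)

    -- A vertex is coloured by its position in the clique which contains it.
    disjoint-cliques-colourable : ¬ HasClique G (suc k) → Colourable G k
    disjoint-cliques-colourable {k} clique-free = (λ x → fromℕ< (position<k x)) , proper
      where
      position : Fin n → ℕ
      position x = toℕ (Any.index (∈-cluster x))
      position<k : ∀ x → position x < k
      position<k x = ℕ.<-≤-trans (toℕ<n (Any.index (∈-cluster x)))
        (ℕ.≮⇒≥ λ k<length → clique-free (hasClique-≤ G k<length (cluster-clique x)))
      position-injective : ∀ {x y xs ys} (x∈ : x ∈ xs) (y∈ : y ∈ ys) → xs ≡ ys →
                           toℕ (Any.index x∈) ≡ toℕ (Any.index y∈) → x ≡ y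
      position-injective x∈ y∈ refl q = index-injective (setoid _) x∈ y∈ (toℕ-injective q)
      proper : Proper G λ x → fromℕ< (position<k x)
      proper x y x~y q = ~⇒≢ x~y (position-injective (∈-cluster x) (∈-cluster y) (cluster-cong (inj₂ x~y))
        (fromℕ<-injective _ _ (position<k x) (position<k y) q))

module _ (G : Graph (Fin n)) where

  open Adjacency G

  common-neighbourhood-colourable : {c : Fin m → Fin n} → IsClique G c → ¬ NearClique G (suc m) →
                                    ¬ HasClique G (m + suc k) → Colourable (G ↾ (λ x → ∀ i → c i ~ x)) k
  common-neighbourhood-colourable {c = c} isClique near-clique-free clique-free =
    colourable-subset G (λ x → all? λ i → c i ~? x) λ ι ι-injective c~ι →
      disjoint-cliques-colourable (restrict G ι) (~-trans ι ι-injective c~ι)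
        λ (d , _ , d-clique) → clique-free (join-cliques G isClique d-clique λ i j → c~ι (d j) i)
    where
    ~-trans : ∀ {l} (ι : Fin l → Fin n) → Injective _≡_ _≡_ ι → (∀ x i → c i ~ ι x) →
              ∀ {x y z} → ι x ~ ι y → ι y ~ ι z → x ≢ z → ι x ~ ι z
    ~-trans ι ι-injective c~ι {x} {y} {z} x~y y~z x≢z = decidable-stable (ι x ~? ι z) λ ¬x~z →
      near-clique-free (mkNearClique (x≢z ∘ ι-injective) (¬~⇒≁ ¬x~z)
        (isClique-∷ G (λ i → ~-sym (c~ι y i)) isClique)
        (λ { zero → x~y ; (suc i) → ~-sym (c~ι x i) })
        (λ { zero → ~-sym y~z ; (suc i) → ~-sym (c~ι z i) }))

  neighbourhood-colourable : ¬ NearClique G 2 → ¬ HasClique G (2 + k) → ∀ u → Colourable (G ↾ (u ~_)) k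
  neighbourhood-colourable near-clique-free clique-free u = colourable-⊆ G (λ { u~x zero → u~x })
    (common-neighbourhood-colourable (vertex-isClique G u) near-clique-free clique-free)

  edge-neighbourhood-colourable : ¬ NearClique G 3 → ¬ HasClique G (3 + k) → ∀ {u v} → u ~ v →
                                  Colourable (G ↾ (λ x → u ~ x × v ~ x)) k
  edge-neighbourhood-colourable near-clique-free clique-free u~v =
    colourable-⊆ G (λ { (u~x , v~x) zero → u~x ; (u~x , v~x) (suc zero) → v~x })
      (common-neighbourhood-colourable (edge-isClique G u~v) near-clique-free clique-free)

  far? : ∀ u v → Decidable (Far G u v)
  far? u v x = (adj G u x Bool.≟ false) ×-dec (adj G v x Bool.≟ false)

  far-colourable : ∀ {u v} → u ~ v → Free (pK2 (suc p)) G →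
    (∀ {m} (ι : Fin m → Fin n) → Injective _≡_ _≡_ ι → Free (pK2 p) (restrict G ι) → Colourable (restrict G ι) k) →
    Colourable (G ↾ Far G u v) k
  far-colourable {u = u} {v} u~v free colour = colourable-subset G (far? u v) λ ι ι-injective far →
    colour ι ι-injective (far-matching-free G ι u~v ι-injective far free)

  near-far-colourable : ∀ {u v} → ¬ NearClique G 2 → ¬ HasClique G (2 + k) → Colourable (G ↾ Far G u v) l →
                        Colourable G (k + k + l)
  near-far-colourable {k} {u = u} {v} near-clique-free clique-free far = colourable-cover G near-or-far
    (colourable-∪ G (colourable-∪ G (near u) (near v)) far)
    where
    near : ∀ w → Colourable (G ↾ (w ~_)) k
    near = neighbourhood-colourable near-clique-free clique-free
    near-or-far : ∀ x → (u ~ x ⊎ v ~ x) ⊎ Far G u v x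
    near-or-far x with u ~? x | v ~? x
    ... | yes u~x | _       = inj₁ (inj₁ u~x)
    ... | no _    | yes v~x = inj₁ (inj₂ v~x)
    ... | no ¬u~x | no ¬v~x = inj₂ (¬~⇒≁ ¬u~x , ¬~⇒≁ ¬v~x)

-- Large cliques

module _ (G : Graph (Fin n)) {c : Fin m → Fin n} (isClique : IsClique G c) where

  open Adjacency G

  Outer : Fin n → Set
  Outer x = ∀ i → c i ≢ x

  outer-independent⇒colourable : (∀ {x y} → Outer x → Outer y → ¬ x ~ y) → (∀ x → ∃ λ i → ¬ x ~ c i) → Colourable G m
  outer-independent⇒colourable independent missed = proj₁ ∘ slot , λ x y x~y → proper (slot x) (slot y) x~y
    where
    Slot : Fin n → Set
    Slot x = ∃ λ i → c i ≡ x ⊎ Outer x × ¬ x ~ c i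
    slot : ∀ x → Slot x
    slot x with any? (λ i → c i Fin.≟ x)
    ... | yes (i , cᵢ≡x) = i , inj₁ cᵢ≡x
    ... | no outer       = Product.map₂ (λ ¬x~cᵢ → inj₂ ((λ i cᵢ≡x → outer (i , cᵢ≡x)) , ¬x~cᵢ)) (missed x)
    proper : ∀ {x y} (x∈ : Slot x) (y∈ : Slot y) → x ~ y → proj₁ x∈ ≢ proj₁ y∈
    proper (i , inj₁ refl)          (_ , inj₁ refl)          x~x refl = ~⇒≢ x~x refl
    proper (i , inj₁ refl)          (_ , inj₂ (_ , ¬y~cᵢ))   c~y refl = ¬y~cᵢ (~-sym c~y)
    proper (i , inj₂ (_ , ¬x~cᵢ))   (_ , inj₁ refl)          x~c refl = ¬x~cᵢ x~c
    proper (i , inj₂ (outer-x , _)) (_ , inj₂ (outer-y , _)) x~y refl = independent outer-x outer-y x~y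

  module _ (maximal : ¬ HasClique G (suc m)) where

    misses-vertex : ∀ x → ∃ λ i → ¬ x ~ c i
    misses-vertex x = ¬∀⟶∃¬ m _ (λ i → x ~? c i) λ x~c → maximal (isClique⇒hasClique G (isClique-∷ G x~c isClique))

    missed : Fin n → List (Fin m) → List (Fin m)
    missed x = filter (∁? λ i → x ~? c i)

    module _ {t : ℕ} (near-clique-free : ¬ NearClique G (suc t)) where

      few-neighbours : ∀ {x is} → Outer x → Unique is → length (filter (λ i → x ~? c i) is) ≤ t
      few-neighbours {x} {is} outer unique = ℕ.≮⇒≥ λ t< → near-clique-free (too-many t<)
        where
        neighbours : List (Fin m)
        neighbours = filter (λ i → x ~? c i) is
        too-many : t < length neighbours → NearClique G (suc t)
        too-many t< with misses-vertex x
        ... | d , ¬x~d = mkNearClique (outer d ∘ ≡-sym) (¬~⇒≁ ¬x~d) (isClique-∘ G base-injective isClique) x~base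
          λ j → isClique d (base j) λ { refl → ¬x~d (x~base j) }
          where
          base : Fin (suc t) → Fin m
          base j = lookup neighbours (inject≤ j t<)
          base-injective : Injective _≡_ _≡_ base
          base-injective q = inject≤-injective t< t< _ _ (lookup-injective (Unique.filter⁺ _ unique) q)
          x~base : ∀ j → x ~ c (base j)
          x~base j = All.lookup (All.all-filter _ is) (∈-lookup (inject≤ j t<))

      missed-length : ∀ {x is s} → Outer x → Unique is → t + s ≤ length is → s ≤ length (missed x is)
      missed-length {x} {is} {s} outer unique t+s≤ = ℕ.+-cancelˡ-≤ t _ _ (begin
        t + s                                                         ≤⟨ t+s≤ ⟩
        length is                                                     ≡⟨ length-filter-∁ (λ i → x ~? c i) is ⟨
        length (filter (λ i → x ~? c i) is) + length (missed x is)    ≤⟨ ℕ.+-monoˡ-≤ _ (few-neighbours outer unique) ⟩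
        t + length (missed x is)                                      ∎)
        where open ℕ.≤-Reasoning

      -- Two adjacent outer vertices would both miss two vertices of the clique.
      outer-independent : Free (pK2 2) G → t + (t + 2) ≤ m → ∀ {x y} → Outer x → Outer y → ¬ x ~ y
      outer-independent 2K2-free large {x} {y} outer-x outer-y x~y = both-missed (missed y (missed x (allFin m)))
        (missed-length outer-y (Unique.filter⁺ _ (Unique.allFin⁺ m))
          (missed-length outer-x (Unique.allFin⁺ m)
            (subst (t + (t + 2) ≤_) (≡-sym (length-tabulate {n = m} (λ i → i))) large)))
        (Unique.filter⁺ _ (Unique.filter⁺ _ (Unique.allFin⁺ m)))
        (All.filter⁺ _ (All.all-filter _ (allFin m)))
        (All.all-filter _ (missed x (allFin m)))
        where
        both-missed : ∀ is → 2 ≤ length is → Unique is → All (λ i → ¬ x ~ c i) is → All (λ i → ¬ y ~ c i) is → ⊥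
        both-missed (_ ∷ [])    (ℕ.s≤s ())
        both-missed (i ∷ j ∷ _) _ ((i≢j ∷ _) ∷ _) (¬x~i ∷ ¬x~j ∷ _) (¬y~i ∷ ¬y~j ∷ _) =
          2K2-free (two-edges G x~y (isClique i j i≢j) (¬~⇒≁ ¬x~i , ¬~⇒≁ ¬y~i) (¬~⇒≁ ¬x~j , ¬~⇒≁ ¬y~j))

large-clique-colourable : ∀ (G : Graph (Fin n)) t → Free (pK2 2) G → ¬ NearClique G (suc t) → t + (t + 2) ≤ m →
                          HasClique G m → ¬ HasClique G (suc m) → Colourable G m
large-clique-colourable G t 2K2-free near-clique-free large (c , _ , isClique) maximal =
  outer-independent⇒colourable G isClique
    (outer-independent G isClique maximal near-clique-free 2K2-free large) (misses-vertex G isClique maximal)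

-- Patterns

-- A pattern records what is known about a sequence of vertices: its i-th row relates vertex i to the vertices i + 1, i + 2, …
Relation : Set
Relation = Fin 4

pattern apart    = zero
pattern adjacent = suc zero
pattern equal    = suc (suc zero)
pattern unknown  = suc (suc (suc zero))

Row Pattern : Set
Row     = List Relation
Pattern = List Row

entry : Row → ℕ → Relation
entry []      _       = unknown
entry (a ∷ _) zero    = a
entry (_ ∷ r) (suc j) = entry r j

relation : Pattern → ℕ → ℕ → Relation
relation []      _       _       = unknown
relation (_ ∷ _) zero    zero    = equal
relation (r ∷ _) zero    (suc j) = entry r j
relation (r ∷ _) (suc i) zero    = entry r i
relation (_ ∷ P) (suc i) (suc j) = relation P i j

Incompatible : Relation → Relation → Set
Incompatible a b = a ≢ b × a ≢ unknown × b ≢ unknown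

incompatible? : ∀ a b → Dec (Incompatible a b)
incompatible? a b = ¬? (a Fin.≟ b) ×-dec ¬? (a Fin.≟ unknown) ×-dec ¬? (b Fin.≟ unknown)

infixr 5 _◂_

_◂_ : V → (ℕ → V) → ℕ → V
(x ◂ φ) zero    = x
(x ◂ φ) (suc i) = φ i

module _ (G : Graph V) where

  open Adjacency G

  Link : Relation → V → V → Set
  Link apart    x y = x ≢ y × x ≁ y
  Link adjacent x y = x ~ y
  Link equal    x y = x ≡ y
  Link unknown  x y = ⊤

  link-sym : ∀ a {x y} → Link a x y → Link a y x
  link-sym apart    (x≢y , x≁y) = ≢-sym x≢y , ≁-sym x≁y
  link-sym adjacent x~y         = ~-sym x~y
  link-sym equal    x≡y         = ≡-sym x≡y
  link-sym unknown  _           = tt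

  incompatible-links : ∀ a b {x y} → Incompatible a b → Link a x y → ¬ Link b x y
  incompatible-links apart    apart    (a≢b , _)           _         _         = a≢b refl
  incompatible-links apart    adjacent _                   (_ , x≁y) x~y       = ≁⇒¬~ x≁y x~y
  incompatible-links apart    equal    _                   (x≢y , _) x≡y       = x≢y x≡y
  incompatible-links adjacent apart    _                   x~y       (_ , x≁y) = ≁⇒¬~ x≁y x~y
  incompatible-links adjacent adjacent (a≢b , _)           _         _         = a≢b refl
  incompatible-links adjacent equal    _                   x~y       x≡y       = ~⇒≢ x~y x≡y
  incompatible-links equal    apart    _                   x≡y       (x≢y , _) = x≢y x≡y
  incompatible-links equal    adjacent _                   x≡y       x~y       = ~⇒≢ x~y x≡y
  incompatible-links equal    equal    (a≢b , _)           _         _         = a≢b refl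
  incompatible-links unknown  _        (_ , a≢unknown , _) _         _         = a≢unknown refl
  incompatible-links _        unknown  (_ , _ , b≢unknown) _         _         = b≢unknown refl

  RealisesRow : (ℕ → V) → V → Row → Set
  RealisesRow φ x r = ∀ j → Link (entry r j) x (φ j)

  Realises : (ℕ → V) → Pattern → Set
  Realises φ P = ∀ i j → Link (relation P i j) (φ i) (φ j)

  Avoids : Pattern → Set
  Avoids P = ∀ φ → ¬ Realises φ P

  realisesRow-◂ : ∀ {φ x y a r} → Link a x y → RealisesRow φ x r → RealisesRow (y ◂ φ) x (a ∷ r)
  realisesRow-◂ xy xr zero    = xy
  realisesRow-◂ xy xr (suc j) = xr j

  realises-◂ : ∀ {φ x r P} → RealisesRow φ x r → Realises φ P → Realises (x ◂ φ) (r ∷ P)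
  realises-◂         xr φP zero    zero    = refl
  realises-◂         xr φP zero    (suc j) = xr j
  realises-◂ {r = r} xr φP (suc i) zero    = link-sym (entry r i) (xr i)
  realises-◂         xr φP (suc i) (suc j) = φP i j

  realises-head : ∀ {φ r P} → Realises φ (r ∷ P) → RealisesRow (φ ∘ suc) (φ 0) r
  realises-head φP j = φP 0 (suc j)

  realises-tail : ∀ {φ r P} → Realises φ (r ∷ P) → Realises (φ ∘ suc) P
  realises-tail φP i j = φP (suc i) (suc j)

  realisesRow-applyUpTo : ∀ {φ x} (ρ : ℕ → Relation) i → (∀ {j} → j < i → Link (ρ j) x (φ j)) →
                          RealisesRow φ x (applyUpTo ρ i)
  realisesRow-applyUpTo ρ zero    links j       = tt
  realisesRow-applyUpTo ρ (suc i) links zero    = links ℕ.z<s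
  realisesRow-applyUpTo ρ (suc i) links (suc j) = realisesRow-applyUpTo (ρ ∘ suc) i (links ∘ ℕ.s<s) j

  realisesRow-replicate : ∀ {φ x a} i → RealisesRow φ x (replicate i a) → ∀ {j} → j < i → Link a x (φ j)
  realisesRow-replicate (suc i) xr {zero}  _           = xr 0
  realisesRow-replicate (suc i) xr {suc j} (ℕ.s≤s j<i) = realisesRow-replicate i (xr ∘ suc) j<i

avoids-[] : (G : Graph (Fin n)) → Avoids G [] → Colourable G k
avoids-[] {zero}  G _      = (λ ()) , λ ()
avoids-[] {suc n} G avoids = contradiction (λ _ _ → tt) (avoids (λ _ → zero))

module _ {G : Graph V} {ι : W → V} (ι-injective : Injective _≡_ _≡_ ι) where

  link-restrict : ∀ a {x y} → Link (restrict G ι) a x y → Link G a (ι x) (ι y)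
  link-restrict apart    (x≢y , x≁y) = x≢y ∘ ι-injective , x≁y
  link-restrict adjacent x~y         = x~y
  link-restrict equal    x≡y         = cong ι x≡y
  link-restrict unknown  _           = tt

  avoids-restrict : ∀ P → Avoids G P → Avoids (restrict G ι) P
  avoids-restrict P avoids φ φP = avoids (ι ∘ φ) λ i j → link-restrict (relation P i j) (φP i j)

cliquePattern : ℕ → Pattern
cliquePattern zero    = []
cliquePattern (suc m) = replicate m adjacent ∷ cliquePattern m

nearCliquePattern : ℕ → Pattern
nearCliquePattern m = (apart ∷ replicate m adjacent) ∷ replicate m adjacent ∷ cliquePattern m

matchingPattern : ℕ → Pattern
matchingPattern zero    = []
matchingPattern (suc p) = (adjacent ∷ replicate (p * 2) apart) ∷ replicate (p * 2) apart ∷ matchingPattern p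

module _ (G : Graph V) where

  open Adjacency G

  cliquePattern-isClique : ∀ m {φ} → Realises G φ (cliquePattern m) → IsClique G {Fin m} (φ ∘ toℕ)
  cliquePattern-isClique (suc m) φP zero    zero    0≢0 = contradiction refl 0≢0
  cliquePattern-isClique (suc m) φP zero    (suc j) _   = realisesRow-replicate G m (realises-head G φP) (toℕ<n j)
  cliquePattern-isClique (suc m) φP (suc i) zero    _   =
    ~-sym (realisesRow-replicate G m (realises-head G φP) (toℕ<n i))
  cliquePattern-isClique (suc m) φP (suc i) (suc j) i≢j =
    cliquePattern-isClique m (realises-tail G φP) i j (i≢j ∘ cong suc)

  avoids-clique : ∀ m → ¬ HasClique G m → Avoids G (cliquePattern m)
  avoids-clique m clique-free φ φP = clique-free (isClique⇒hasClique G (cliquePattern-isClique m φP))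

  avoids-nearClique : ∀ m → ¬ NearClique G m → Avoids G (nearCliquePattern m)
  avoids-nearClique m near-clique-free φ φP = near-clique-free (mkNearClique (proj₁ a-apart-b) (proj₂ a-apart-b)
    (cliquePattern-isClique m (realises-tail G (realises-tail G φP)))
    (λ i → realisesRow-replicate G m (realises-head G φP ∘ suc) (toℕ<n i))
    (λ i → realisesRow-replicate G m (realises-head G (realises-tail G φP)) (toℕ<n i)))
    where
    a-apart-b : Link G apart (φ 0) (φ 1)
    a-apart-b = φP 0 1

  matchingPattern-matching : ∀ p {φ} → Realises G φ (matchingPattern p) →
    Σ (InducedSubgraph (pK2 p) G) λ (ψ , _) → ∀ s → ∃ λ j → j < p * 2 × ψ s ≡ φ j
  matchingPattern-matching zero        φP = empty-matching G , λ { (() , _) }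
  matchingPattern-matching (suc p) {φ} φP with matchingPattern-matching p (realises-tail G (realises-tail G φP))
  ... | ψ , ψ∈φ = extend-matching G (φP 0 1) ψ far , λ
    { (zero  , zero)     → 0 , ℕ.z<s , refl
    ; (zero  , suc zero) → 1 , ℕ.s<s ℕ.z<s , refl
    ; (suc i , x)        → Product.map (2 +_) (Product.map₁ (ℕ.s<s ∘ ℕ.s<s)) (ψ∈φ (i , x)) }
    where
    far : ∀ s → Far G (φ 0) (φ 1) (proj₁ ψ s)
    far s with proj₁ ψ s | ψ∈φ s
    ... | _ | j , j<2p , refl =
      proj₂ (realisesRow-replicate G (p * 2) (realises-head G φP ∘ suc) j<2p) ,
      proj₂ (realisesRow-replicate G (p * 2) (realises-head G (realises-tail G φP)) j<2p)

  avoids-matching : ∀ p → Free (pK2 p) G → Avoids G (matchingPattern p)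
  avoids-matching p free φ φP = free (proj₁ (matchingPattern-matching p φP))

-- Occurrences of patterns in patterns

RowEmbeds : Pattern → ℕ → Row → List ℕ → Set
RowEmbeds M i = Pointwise λ a j → a ≡ relation M i j

Embeds : Pattern → Pattern → List ℕ → Set
Embeds M []      []       = ⊤
Embeds M (r ∷ P) (i ∷ is) = RowEmbeds M i r is × Embeds M P is
Embeds M _       _        = ⊥

embeds? : ∀ M P is → Dec (Embeds M P is)
embeds? M []      []       = yes tt
embeds? M (r ∷ P) (i ∷ is) = Pointwise.decidable (λ a j → a Fin.≟ relation M i j) r is ×-dec embeds? M P is
embeds? M []      (_ ∷ _)  = no λ ()
embeds? M (_ ∷ _) []       = no λ ()

Occurrence : Set
Occurrence = Pattern × List ℕ

Excluded : List Occurrence → Pattern → Set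
Excluded os M = Any (λ (P , is) → Embeds M P is) os

excluded? : ∀ os M → Dec (Excluded os M)
excluded? os M = Any.any? (λ (P , is) → embeds? M P is) os

Clash : Relation → Row → Row → Set
Clash a r s = Any (λ (b , c) → b ≡ equal × Incompatible a c ⊎ c ≡ equal × Incompatible a b) (zip r s)

clash? : ∀ a r s → Dec (Clash a r s)
clash? a r s = Any.any?
  (λ (b , c) → ((b Fin.≟ equal) ×-dec incompatible? a c) ⊎-dec ((c Fin.≟ equal) ×-dec incompatible? a b)) (zip r s)

image : List ℕ → ℕ → ℕ
image []       _       = 0
image (i ∷ is) zero    = i
image (i ∷ is) (suc j) = image is j

module _ (G : Graph V) where

  OccurrencesAvoided : List Occurrence → Set
  OccurrencesAvoided = All (Avoids G ∘ proj₁)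

  rowEmbeds-realises : ∀ M {φ i r is} → Realises G φ M → RowEmbeds M i r is → RealisesRow G (φ ∘ image is) (φ i) r
  rowEmbeds-realises M         φM []           _       = tt
  rowEmbeds-realises M {i = i} φM (refl ∷ _)   zero    = φM i _
  rowEmbeds-realises M         φM (_ ∷ embeds) (suc j) = rowEmbeds-realises M φM embeds j

  embeds-realises : ∀ M {φ} P is → Realises G φ M → Embeds M P is → Realises G (φ ∘ image is) P
  embeds-realises M []      []       φM _               _       _       = tt
  embeds-realises M (r ∷ P) (i ∷ is) φM _               zero    zero    = refl
  embeds-realises M (r ∷ P) (i ∷ is) φM (rowEmbeds , _) zero    (suc j) = rowEmbeds-realises M φM rowEmbeds j
  embeds-realises M (r ∷ P) (i ∷ is) φM (rowEmbeds , _) (suc j) zero    =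
    link-sym G (entry r j) (rowEmbeds-realises M φM rowEmbeds j)
  embeds-realises M (r ∷ P) (i ∷ is) φM (_ , embeds)    (suc j) (suc l) = embeds-realises M P is φM embeds j l

  realised⇒not-excluded : ∀ {os M φ} → OccurrencesAvoided os → Realises G φ M → ¬ Excluded os M
  realised⇒not-excluded {M = M} avoided φM excluded with (avoids , embeds) ← All.lookupAny avoided excluded =
    avoids _ (embeds-realises M _ _ φM embeds)

  realised⇒no-clash : ∀ {φ x y} a r s → RealisesRow G φ x r → RealisesRow G φ y s → Link G a x y → ¬ Clash a r s
  realised⇒no-clash a (_ ∷ r) (c ∷ s) xr ys xy (here (inj₁ (refl , a≠c))) =
    incompatible-links G a c a≠c (subst (λ z → Link G a z _) (xr 0) xy) (link-sym G c (ys 0))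
  realised⇒no-clash a (b ∷ r) (_ ∷ s) xr ys xy (here (inj₂ (refl , a≠b))) =
    incompatible-links G a b a≠b (subst (Link G a _) (ys 0) xy) (xr 0)
  realised⇒no-clash a (_ ∷ r) (_ ∷ s) xr ys xy (there clash) =
    realised⇒no-clash a r s (xr ∘ suc) (ys ∘ suc) xy clash

-- Classes and labels

data Label : Set where
  fixed split : ℕ → Label

isFixed? : ∀ c ℓ → Dec (ℓ ≡ fixed c)
isFixed? c (fixed d) = map′ (cong fixed) (λ { refl → refl }) (d ℕ.≟ c)
isFixed? c (split _) = no λ ()

data Role : Set where
  plain lower raised : ℕ → Role

isPlain? : ∀ c ρ → Dec (ρ ≡ plain c)
isPlain? c (plain d)  = map′ (cong plain) (λ { refl → refl }) (d ℕ.≟ c)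
isPlain? c (lower _)  = no λ ()
isPlain? c (raised _) = no λ ()

colour : Role → ℕ
colour (plain c)  = c
colour (lower c)  = c
colour (raised c) = suc c

-- Of the vertices labelled split c, those with a neighbour labelled fixed c are raised, the others lower.
roles : Label → List Role
roles (fixed c) = plain c ∷ []
roles (split c) = lower c ∷ raised c ∷ []

label : ℕ → Label
label d with d ℕ.<? 8
... | yes _ = fixed d
... | no  _ = split (d ∸ 8)

labelled : ℕ → List Row → List (Row × Label)
labelled ds []       = []
labelled ds (r ∷ rs) = (r , label (ds % 16)) ∷ labelled (ds / 16) rs

labelled-row : ∀ ds {rs r} → r ∈ rs → ∃ λ ℓ → (r , ℓ) ∈ labelled ds rs
labelled-row ds (here refl) = _ , here refl
labelled-row ds (there r∈)  = Product.map₂ there (labelled-row (ds / 16) r∈)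

Class : Set
Class = Row × Role

-- Certificate rules for a graph which contains H

module Checker (k : ℕ) (H : Pattern) (vertexOccurrences pairOccurrences tripleOccurrences : List Occurrence) where

  extensions : ℕ → List Row
  extensions zero    = [] ∷ []
  extensions (suc i) = filter (λ r → ¬? (excluded? vertexOccurrences (r ∷ H)))
    (cartesianProductWith _∷ʳ_ (extensions i) (apart ∷ adjacent ∷ []))

  rows : List Row
  rows = applyUpTo (λ i → applyUpTo (relation H i) (length H)) (length H) ++ extensions (length H)

  classes : ℕ → List Class
  classes ds = concatMap (λ (r , ℓ) → map (r ,_) (roles ℓ)) (labelled ds rows)

  Dominated : ℕ → ℕ → Set
  Dominated u v = relation H u v ≡ apart ×
    All (λ r → Incompatible adjacent (entry r u) ⊎ entry r v ≡ adjacent) rows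

  dominated? : ∀ u v → Dec (Dominated u v)
  dominated? u v = (relation H u v Fin.≟ apart) ×-dec
    All.all? (λ r → incompatible? adjacent (entry r u) ⊎-dec (entry r v Fin.≟ adjacent)) rows

  NoEdge : Row → Row → Set
  NoEdge r s = Clash adjacent r s ⊎ Excluded pairOccurrences ((adjacent ∷ r) ∷ s ∷ H)

  noEdge? : ∀ r s → Dec (NoEdge r s)
  noEdge? r s = clash? adjacent r s ⊎-dec excluded? pairOccurrences ((adjacent ∷ r) ∷ s ∷ H)

  NoTriple : Relation → Row → Row → Row → Set
  NoTriple a r s t = Clash a s t ⊎ Excluded tripleOccurrences ((a ∷ adjacent ∷ s) ∷ (adjacent ∷ t) ∷ r ∷ H)

  noTriple? : ∀ a r s t → Dec (NoTriple a r s t)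
  noTriple? a r s t = clash? a s t ⊎-dec excluded? tripleOccurrences ((a ∷ adjacent ∷ s) ∷ (adjacent ∷ t) ∷ r ∷ H)

  NoCommonNeighbour : Row → Row → Row → Set
  NoCommonNeighbour r s t = NoEdge r t ⊎ All (λ a → NoTriple a r s t) (apart ∷ adjacent ∷ [])

  noCommonNeighbour? : ∀ r s t → Dec (NoCommonNeighbour r s t)
  noCommonNeighbour? r s t = noEdge? r t ⊎-dec All.all? (λ a → noTriple? a r s t) (apart ∷ adjacent ∷ [])

  SeparatedByRole : List Class → Class → Class → Set
  SeparatedByRole L (r , plain _)  _       = ⊥
  SeparatedByRole L (r , lower c)  (_ , σ) = σ ≡ plain c
  SeparatedByRole L (r , raised c) (s , _) = All (λ (t , τ) → τ ≡ plain c → NoCommonNeighbour r s t) L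

  separatedByRole? : ∀ L X Y → Dec (SeparatedByRole L X Y)
  separatedByRole? L (r , plain _)  _       = no λ ()
  separatedByRole? L (r , lower c)  (_ , σ) = isPlain? c σ
  separatedByRole? L (r , raised c) (s , _) = All.all? (λ (t , τ) → isPlain? c τ →-dec noCommonNeighbour? r s t) L

  Compatible : List Class → Class → Class → Set
  Compatible L X@(r , ρ) Y@(s , σ) =
    colour ρ ≢ colour σ ⊎ NoEdge r s ⊎ SeparatedByRole L X Y ⊎ SeparatedByRole L Y X

  compatible? : ∀ L X Y → Dec (Compatible L X Y)
  compatible? L X@(r , ρ) Y@(s , σ) =
    ¬? (colour ρ ℕ.≟ colour σ) ⊎-dec noEdge? r s ⊎-dec separatedByRole? L X Y ⊎-dec separatedByRole? L Y X

  ValidColouring : List Class → Set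
  ValidColouring L = All (λ (_ , ρ) → colour ρ < k) L × All (λ X → Compatible L X X) L × AllPairs (Compatible L) L

  validColouring? : ∀ L → Dec (ValidColouring L)
  validColouring? L = All.all? (λ (_ , ρ) → colour ρ ℕ.<? k) L ×-dec
    All.all? (λ X → compatible? L X X) L ×-dec AllPairs.allPairs? (compatible? L) L

module Soundness (G : Graph (Fin n)) (k : ℕ) (H : Pattern)
  {vertexOccurrences pairOccurrences tripleOccurrences : List Occurrence}
  (vertexAvoided : OccurrencesAvoided G vertexOccurrences) (pairAvoided : OccurrencesAvoided G pairOccurrences)
  (tripleAvoided : OccurrencesAvoided G tripleOccurrences) (φ : ℕ → Fin n) (φH : Realises G φ H) where

  open Adjacency G
  open Checker k H vertexOccurrences pairOccurrences tripleOccurrences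

  relationTo : Fin n → Fin n → Relation
  relationTo x y with x ~? y
  ... | yes _ = adjacent
  ... | no _  = apart

  relationTo-link : ∀ {x y} → x ≢ y → Link G (relationTo x y) x y
  relationTo-link {x} {y} x≢y with x ~? y
  ... | yes x~y = x~y
  ... | no ¬x~y = x≢y , ¬~⇒≁ ¬x~y

  relationTo-∈ : ∀ x y → relationTo x y ∈ apart ∷ adjacent ∷ []
  relationTo-∈ x y with x ~? y
  ... | yes _ = there (here refl)
  ... | no _  = here refl

  extension-row : ∀ {x} → (∀ {j} → j < length H → x ≢ φ j) → ∀ i → i ≤ length H →
                  applyUpTo (relationTo x ∘ φ) i ∈ extensions i
  extension-row     x≢φ zero    _   = here refl
  extension-row {x} x≢φ (suc i) i<n = subst (_∈ extensions (suc i)) (applyUpTo-∷ʳ ρ i)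
    (∈-filter⁺ _ (∈-cartesianProductWith⁺ _∷ʳ_ (extension-row x≢φ i (ℕ.<⇒≤ i<n)) (relationTo-∈ x (φ i)))
      (realised⇒not-excluded G vertexAvoided (realises-◂ G ρ-realised φH)))
    where
    ρ : ℕ → Relation
    ρ = relationTo x ∘ φ
    ρ-realised : RealisesRow G φ x (applyUpTo ρ i ∷ʳ ρ i)
    ρ-realised = subst (RealisesRow G φ x) (≡-sym (applyUpTo-∷ʳ ρ i))
      (realisesRow-applyUpTo G ρ (suc i) λ j≤i → relationTo-link (x≢φ (ℕ.<-≤-trans j≤i i<n)))

  row-of : ∀ x → ∃ λ r → r ∈ rows × RealisesRow G φ x r
  row-of x with ℕ.anyUpTo? (λ j → x Fin.≟ φ j) (length H)
  ... | yes (j , j<n , refl) =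
    applyUpTo (relation H j) (length H) ,
    ∈-++⁺ˡ (∈-applyUpTo⁺ _ j<n) ,
    realisesRow-applyUpTo G (relation H j) (length H) (λ {l} _ → φH j l)
  ... | no new =
    applyUpTo (relationTo x ∘ φ) (length H) ,
    ∈-++⁺ʳ (applyUpTo _ (length H)) (extension-row x≢φ (length H) ℕ.≤-refl) ,
    realisesRow-applyUpTo G _ (length H) (relationTo-link ∘ x≢φ)
    where
    x≢φ : ∀ {j} → j < length H → x ≢ φ j
    x≢φ j<n x≡φj = new (_ , j<n , x≡φj)

  dominated-sound : ∀ {u v} → Dominated u v → φ u ≢ φ v × (∀ w → w ~ φ u → w ~ φ v)
  dominated-sound {u} {v} (u-apart-v , N[u]⊆N[v]) =
    proj₁ (subst (λ a → Link G a (φ u) (φ v)) u-apart-v (φH u v)) , neighbours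
    where
    neighbours : ∀ w → w ~ φ u → w ~ φ v
    neighbours w w~u with row-of w
    ... | r , r∈rows , wr with All.lookup N[u]⊆N[v] r∈rows
    ... | inj₁ incompatible = contradiction (wr u) (incompatible-links G adjacent (entry r u) incompatible w~u)
    ... | inj₂ v-adjacent   = subst (λ a → Link G a w (φ v)) v-adjacent (wr v)

  no-edge : ∀ {x y r s} → RealisesRow G φ x r → RealisesRow G φ y s → NoEdge r s → ¬ x ~ y
  no-edge xr ys (inj₁ clash)    x~y = realised⇒no-clash G adjacent _ _ xr ys x~y clash
  no-edge xr ys (inj₂ excluded) x~y =
    realised⇒not-excluded G pairAvoided (realises-◂ G (realisesRow-◂ G x~y xr) (realises-◂ G ys φH)) excluded

  no-triple : ∀ {x y z r s t} a → RealisesRow G φ x r → RealisesRow G φ y s → RealisesRow G φ z t →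
              NoTriple a r s t → x ~ y → x ~ z → ¬ Link G a y z
  no-triple a xr ys zt (inj₁ clash)    x~y x~z yz = realised⇒no-clash G a _ _ ys zt yz clash
  no-triple a xr ys zt (inj₂ excluded) x~y x~z yz = realised⇒not-excluded G tripleAvoided
    (realises-◂ G (realisesRow-◂ G yz (realisesRow-◂ G (~-sym x~y) ys))
      (realises-◂ G (realisesRow-◂ G (~-sym x~z) zt) (realises-◂ G xr φH))) excluded

  no-common-neighbour : ∀ {x y z r s t} → RealisesRow G φ x r → RealisesRow G φ y s → RealisesRow G φ z t →
                        NoCommonNeighbour r s t → y ≢ z → x ~ y → ¬ x ~ z
  no-common-neighbour         xr ys zt (inj₁ noEdge)   y≢z x~y x~z = no-edge xr zt noEdge x~z
  no-common-neighbour {y = y} {z} xr ys zt (inj₂ noTriple) y≢z x~y x~z =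
    no-triple (relationTo y z) xr ys zt (All.lookup noTriple (relationTo-∈ y z)) x~y x~z (relationTo-link y≢z)

  record Classification (L : List Class) : Set where
    field
      row             : Fin n → Row
      role            : Fin n → Role
      class-∈         : ∀ x → (row x , role x) ∈ L
      row-realised    : ∀ x → RealisesRow G φ x (row x)
      lower-isolated  : ∀ {x y c} → role x ≡ lower c → x ~ y → role y ≢ plain c
      raised-attached : ∀ {x c} → role x ≡ raised c → ∃ λ y → x ~ y × role y ≡ plain c

  module _ (ds : ℕ) where

    rowOf : Fin n → Row
    rowOf x = proj₁ (row-of x)

    labelled-∈ : ∀ x → ∃ λ ℓ → (rowOf x , ℓ) ∈ labelled ds rows
    labelled-∈ x = labelled-row ds (proj₁ (proj₂ (row-of x)))

    labelOf : Fin n → Label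
    labelOf x = proj₁ (labelled-∈ x)

    Attached : Fin n → ℕ → Set
    Attached x c = ∃ λ y → x ~ y × labelOf y ≡ fixed c

    attached? : ∀ x c → Dec (Attached x c)
    attached? x c = any? λ y → (x ~? y) ×-dec isFixed? c (labelOf y)

    roleFor : Fin n → Label → Role
    roleFor x (fixed c) = plain c
    roleFor x (split c) with attached? x c
    ... | yes _ = raised c
    ... | no _  = lower c

    roleFor-∈ : ∀ x ℓ → roleFor x ℓ ∈ roles ℓ
    roleFor-∈ x (fixed c) = here refl
    roleFor-∈ x (split c) with attached? x c
    ... | yes _ = there (here refl)
    ... | no _  = here refl

    roleFor-plain : ∀ x ℓ {c} → roleFor x ℓ ≡ plain c → ℓ ≡ fixed c
    roleFor-plain x (fixed c) refl = refl
    roleFor-plain x (split c) ρ≡ with attached? x c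
    roleFor-plain x (split c) () | yes _
    roleFor-plain x (split c) () | no _

    roleFor-lower : ∀ x ℓ {c} → roleFor x ℓ ≡ lower c → ¬ Attached x c
    roleFor-lower x (split c) ρ≡ with attached? x c
    roleFor-lower x (split c) ()   | yes _
    roleFor-lower x (split c) refl | no isolated = isolated

    roleFor-raised : ∀ x ℓ {c} → roleFor x ℓ ≡ raised c → Attached x c
    roleFor-raised x (split c) ρ≡ with attached? x c
    roleFor-raised x (split c) refl | yes attached = attached
    roleFor-raised x (split c) ()   | no _

    classification : Classification (classes ds)
    classification = record
      { row             = rowOf
      ; role            = λ x → roleFor x (labelOf x)
      ; class-∈         = λ x → ∈-concatMap⁺ _
          (lose (proj₂ (labelled-∈ x)) (∈-map⁺ (rowOf x ,_) (roleFor-∈ x (labelOf x))))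
      ; row-realised    = λ x → proj₂ (proj₂ (row-of x))
      ; lower-isolated  = λ {x} {y} x-lower x~y y-plain →
          roleFor-lower x (labelOf x) x-lower (y , x~y , roleFor-plain y (labelOf y) y-plain)
      ; raised-attached = λ {x} x-raised →
          Product.map₂ (λ {y} → Product.map₂ (cong (roleFor y))) (roleFor-raised x (labelOf x) x-raised)
      }

  module _ {L : List Class} (validColouring : ValidColouring L) (classified : Classification L) where

    open Classification classified

    separatedByRole⇒no-edge : ∀ {x y} → SeparatedByRole L (row x , role x) (row y , role y) →
                              colour (role x) ≡ colour (role y) → ¬ x ~ y
    separatedByRole⇒no-edge {x} separated same-colour x~y with role x in ρ≡
    ... | lower c = lower-isolated ρ≡ x~y separated
    ... | raised c with raised-attached ρ≡
    ... | z , x~z , z-plain =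
      no-common-neighbour (row-realised x) (row-realised _) (row-realised z) (All.lookup separated (class-∈ z) z-plain)
        (λ { refl → ℕ.1+n≢n (trans same-colour (cong colour z-plain)) }) x~y x~z

    compatible⇒colours-differ : ∀ {x y} → Compatible L (row x , role x) (row y , role y) →
                                x ~ y → colour (role x) ≢ colour (role y)
    compatible⇒colours-differ (inj₁ colours≢) _ = colours≢
    compatible⇒colours-differ (inj₂ (inj₁ noEdge)) x~y _ = no-edge (row-realised _) (row-realised _) noEdge x~y
    compatible⇒colours-differ (inj₂ (inj₂ (inj₁ separated))) x~y same-colour =
      separatedByRole⇒no-edge separated same-colour x~y
    compatible⇒colours-differ (inj₂ (inj₂ (inj₂ separated))) x~y same-colour =
      separatedByRole⇒no-edge separated (≡-sym same-colour) (~-sym x~y)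

    validColouring-sound : Colourable G k
    validColouring-sound = (λ x → fromℕ< (bounded x)) , λ x y x~y q →
      proper x~y (fromℕ<-injective _ _ (bounded x) (bounded y) q)
      where
      bounded : ∀ x → colour (role x) < k
      bounded x = All.lookup (proj₁ validColouring) (class-∈ x)
      proper : ∀ {x y} → x ~ y → colour (role x) ≢ colour (role y)
      proper {x} {y} x~y with allPairs-lookup (proj₂ (proj₂ validColouring)) (class-∈ x) (class-∈ y)
      ... | inj₁ same-class        = compatible⇒colours-differ
        (subst (Compatible L _) same-class (All.lookup (proj₁ (proj₂ validColouring)) (class-∈ x))) x~y
      ... | inj₂ (inj₁ compatible) = compatible⇒colours-differ compatible x~y
      ... | inj₂ (inj₂ compatible) = ≢-sym (compatible⇒colours-differ compatible (~-sym x~y))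

-- Certificates

data Forbidden : Set where
  clique nearClique matching : ℕ → Forbidden

forbiddenPattern : Forbidden → Pattern
forbiddenPattern (clique m)     = cliquePattern m
forbiddenPattern (nearClique m) = nearCliquePattern m
forbiddenPattern (matching p)   = matchingPattern p

sublists : {R : A → A → Set} → (∀ x y → Dec (R x y)) → ℕ → List A → List (List A)
sublists R? zero    xs       = [] ∷ []
sublists R? (suc m) []       = []
sublists R? (suc m) (x ∷ xs) = map (x ∷_) (sublists R? m (filter (R? x) xs)) ++ sublists R? (suc m) xs

module _ (M : Pattern) where

  Possible : Relation → ℕ → ℕ → Set
  Possible a i j = relation M i j ≡ a ⊎ relation M i j ≡ unknown

  possible? : ∀ a i j → Dec (Possible a i j)
  possible? a i j = (relation M i j Fin.≟ a) ⊎-dec (relation M i j Fin.≟ unknown)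

  possibleBetween? : ∀ a is js → Dec (All (λ i → All (Possible a i) js) is)
  possibleBetween? a is js = All.all? (λ i → All.all? (possible? a i) js) is

  -- Nothing is claimed about these lists: an occurrence excludes a pattern only if it really embeds.
  candidates : Forbidden → List (List ℕ)
  candidates (clique m)     = sublists (possible? adjacent) m (upTo (length M))
  candidates (nearClique m) = concatMap
    (λ ab → map (ab ++_) (sublists (possible? adjacent) m
      (filter (λ i → possibleBetween? adjacent ab (i ∷ [])) (upTo (length M)))))
    (sublists (possible? apart) 2 (upTo (length M)))
  candidates (matching p)   = map concat
    (sublists (possibleBetween? apart) p (sublists (possible? adjacent) 2 (upTo (length M))))

-- The patterns in question have i new vertices in front of H; an occurrence which misses one of the first two of them would
-- already exclude a pattern with fewer new vertices.
forbiddenOccurrences : List Forbidden → Pattern → ℕ → List Occurrence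
forbiddenOccurrences Fs H i =
  concatMap (λ F → map (forbiddenPattern F ,_) (filter useful? (candidates (replicate i [] ++ H) F))) Fs
  where
  useful? : ∀ is → Dec (All (_∈ is) (upTo (i ⊓ 2)))
  useful? is = All.all? (_∈? is) (upTo (i ⊓ 2))

data Rule : Set where
  dominated : (u v : ℕ) → Rule
  coloured  : (labels : ℕ) → Rule

-- All digits are listed with the least significant first. The binary digits of the i-th number of a graph form the i-th row of
-- its pattern. The hexadecimal digits of an occurrence are two for the number of steps between this one and that of the graph
-- which occurs, and then one for each vertex; those of a colouring are the labels of the rows.
record Step : Set where
  constructor step
  field
    graph       : List ℕ
    occurrences : List ℕ
    rule        : Rule
open Step

digits : (base : ℕ) → .{{ℕ.NonZero base}} → ℕ → ℕ → List ℕ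
digits base zero    _ = []
digits base (suc m) d = d % base ∷ digits base m (d / base)

decodeRelation : ℕ → Relation
decodeRelation 0 = apart
decodeRelation _ = adjacent

decodeGraph : List ℕ → Pattern
decodeGraph []       = []
decodeGraph (b ∷ bs) = map decodeRelation (digits 2 (length bs) b) ∷ decodeGraph bs

graphPattern : Step → Pattern
graphPattern s = decodeGraph (graph s)

decodeOccurrence : List Pattern → ℕ → List Occurrence
decodeOccurrence Ps d = map (λ P → P , digits 16 (length P) (d / 256)) (take 1 (drop (d % 256) Ps))

ValidRule : ℕ → Pattern → (vertexOccurrences pairOccurrences tripleOccurrences : List Occurrence) → Rule → Set
ValidRule k H vertexOs pairOs tripleOs (dominated u v) = Checker.Dominated k H vertexOs pairOs tripleOs u v
ValidRule k H vertexOs pairOs tripleOs (coloured ds)   = ValidColouring (classes ds)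
  where open Checker k H vertexOs pairOs tripleOs

validRule? : ∀ k H vertexOs pairOs tripleOs ρ → Dec (ValidRule k H vertexOs pairOs tripleOs ρ)
validRule? k H vertexOs pairOs tripleOs (dominated u v) = Checker.dominated? k H vertexOs pairOs tripleOs u v
validRule? k H vertexOs pairOs tripleOs (coloured ds)   = validColouring? (classes ds)
  where open Checker k H vertexOs pairOs tripleOs

stepOccurrences : List Forbidden → List Pattern → Step → ℕ → List Occurrence
stepOccurrences Fs Ps s i =
  forbiddenOccurrences Fs (graphPattern s) i ++ concatMap (decodeOccurrence Ps) (occurrences s)

module _ (k : ℕ) (Fs : List Forbidden) where

  ValidStep : List Pattern → Step → Set
  ValidStep Ps s = ValidRule k (graphPattern s) (os 1) (os 2) (os 3) (rule s)
    where
    os : ℕ → List Occurrence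
    os = stepOccurrences Fs Ps s

  validStep? : ∀ Ps s → Dec (ValidStep Ps s)
  validStep? Ps s = validRule? k _ _ _ _ (rule s)

  Valid : List Step → Set
  Valid []       = ⊤
  Valid (s ∷ ss) = ValidStep (map graphPattern ss) s × Valid ss

  valid? : ∀ ss → Dec (Valid ss)
  valid? []       = yes tt
  valid? (s ∷ ss) = validStep? (map graphPattern ss) s ×-dec valid? ss

  -- Agda evaluates does much faster than True (valid? steps).
  record Certificate : Set where
    constructor certificate
    field
      steps   : List Step
      checked : does (valid? steps) ≡ true

does≡true⇒ : {P : Set} (P? : Dec P) → does P? ≡ true → P
does≡true⇒ (yes p) _ = p

module _ (G : Graph (Fin n)) where

  open Adjacency G

  AvoidsForbidden : List Forbidden → Set
  AvoidsForbidden = All (Avoids G ∘ forbiddenPattern)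

  DominatedVerticesRemovable : ℕ → Set
  DominatedVerticesRemovable k = ∀ {u v} → u ≢ v → (∀ w → w ~ u → w ~ v) → Colourable G k

  forbiddenOccurrences-avoided : ∀ {Fs} H i → AvoidsForbidden Fs → OccurrencesAvoided G (forbiddenOccurrences Fs H i)
  forbiddenOccurrences-avoided H i avoidsFs =
    All.concat⁺ (All.map⁺ (All.map (λ avoids → All.map⁺ (All.universal (λ _ → avoids) _)) avoidsFs))

  decodeOccurrence-avoided : ∀ {Ps} ds → All (Avoids G) Ps → OccurrencesAvoided G (concatMap (decodeOccurrence Ps) ds)
  decodeOccurrence-avoided ds avoidsPs =
    All.concat⁺ (All.map⁺ (All.universal (λ d → All.map⁺ (All.take⁺ 1 (All.drop⁺ (d % 256) avoidsPs))) ds))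

  module _ {k : ℕ} {Fs : List Forbidden}
    (removable : DominatedVerticesRemovable k) (avoidsFs : AvoidsForbidden Fs) where

    validStep-sound : ∀ {Ps} s → All (Avoids G) Ps → ValidStep k Fs Ps s →
                      ∀ φ → Realises G φ (graphPattern s) → Colourable G k
    validStep-sound {Ps} s avoidsPs valid φ φH = validRule-sound (rule s) valid
      where
      os : ℕ → List Occurrence
      os = stepOccurrences Fs Ps s
      os-avoided : ∀ i → OccurrencesAvoided G (os i)
      os-avoided i = All.++⁺ (forbiddenOccurrences-avoided (graphPattern s) i avoidsFs)
                             (decodeOccurrence-avoided (occurrences s) avoidsPs)
      open Soundness G k (graphPattern s) (os-avoided 1) (os-avoided 2) (os-avoided 3) φ φH
      validRule-sound : ∀ ρ → ValidRule k (graphPattern s) (os 1) (os 2) (os 3) ρ → Colourable G k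
      validRule-sound (dominated u v) valid = uncurry removable (dominated-sound valid)
      validRule-sound (coloured ds)   valid = validColouring-sound valid (classification ds)

    valid⇒avoids : ¬ Colourable G k → ∀ ss → Valid k Fs ss → All (Avoids G) (map graphPattern ss)
    valid⇒avoids ¬colourable []       _                = []
    valid⇒avoids ¬colourable (s ∷ ss) (valid , valids) =
      (λ φ φH → ¬colourable (validStep-sound s avoidsPs valid φ φH)) ∷ avoidsPs
      where
      avoidsPs : All (Avoids G) (map graphPattern ss)
      avoidsPs = valid⇒avoids ¬colourable ss valids

module _ {Fs : List Forbidden} (C : Certificate k Fs) where

  open Certificate C

  certified :
    (∀ {n} (G : Graph (Fin n)) → AvoidsForbidden G Fs → All (Avoids G) (map graphPattern steps) → Colourable G k) →
    ∀ {n} (G : Graph (Fin n)) → AvoidsForbidden G Fs → Colourable G k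
  certified colour-rest G avoidsFs = decidable-stable (colourable? G k) λ ¬colourable →
    ¬colourable (colour-rest G avoidsFs
      (valid⇒avoids G (removable G avoidsFs) avoidsFs ¬colourable steps (does≡true⇒ (valid? k Fs steps) checked)))
    where
    removable : ∀ {n} (G : Graph (Fin n)) → AvoidsForbidden G Fs → DominatedVerticesRemovable G k
    removable {suc n} G avoidsFs {u} {v} u≢v N[u]⊆N[v] = dominated-vertex-removable G u≢v N[u]⊆N[v]
      (certified colour-rest (restrict G (punchIn u))
        (All.map (λ {F} → avoids-restrict (punchIn-injective u _ _) (forbiddenPattern F)) avoidsFs))

-- Small cases

-- The certificates were found by computer search.

2K2-diamond-K4-certificate : Certificate 3 (matching 2 ∷ nearClique 2 ∷ clique 4 ∷ [])
2K2-diamond-K4-certificate = certificate (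
  step [] (0x1000 ∷ []) (coloured 0x0) ∷
  step (1 ∷ 0 ∷ []) (0x21000 ∷ 0x31000 ∷ []) (coloured 0x1201) ∷
  step (3 ∷ 1 ∷ 0 ∷ []) [] (coloured 0x1200210) ∷
  []) refl

3K2-K3-certificate : Certificate 4 (matching 3 ∷ clique 3 ∷ [])
3K2-K3-certificate = certificate (
  step [] (0x1000 ∷ []) (coloured 0x0) ∷
  step (1 ∷ 0 ∷ []) (0x321000 ∷ []) (coloured 0x1201) ∷
  step (1 ∷ 0 ∷ 1 ∷ 0 ∷ []) (0x436512000 ∷ []) (coloured 0x2223330180123) ∷
  step (9 ∷ 1 ∷ 1 ∷ 1 ∷ 0 ∷ 1 ∷ 0 ∷ [])
    (0x543981200c ∷ 0x670543210c ∷ 0x760543210c ∷ 0x75341209800 ∷ 0x56734120980f ∷ 0x657430218903 ∷ 0x657431209802 ∷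
     0x657431209803 ∷ 0x675340218903 ∷ 0x675341209802 ∷ 0x675341209803 ∷ 0x675341209804 ∷ [])
    (coloured 0x222222223333333301801010180128323) ∷
  step (9 ∷ 1 ∷ 1 ∷ 25 ∷ 0 ∷ 3 ∷ 2 ∷ 0 ∷ 0 ∷ [])
    (0x76234510b ∷ 0x871265430c ∷ 0x1870265430c ∷ 0x5123768090d ∷ [])
    (coloured 0x222222222222222018333333330011333301013308100123823) ∷
  step (9 ∷ 1 ∷ 65 ∷ 25 ∷ 16 ∷ 3 ∷ 2 ∷ 2 ∷ 1 ∷ 0 ∷ [])
    (0x321908670a ∷ 0x670451230a ∷ 0x871623450b ∷ 0x1870265430b ∷ [])
    (coloured 0x222222222222222222200118333333330001113333010133083100123823) ∷
  step (9 ∷ 1 ∷ 17 ∷ 1 ∷ 8 ∷ 3 ∷ 2 ∷ 2 ∷ 1 ∷ 0 ∷ [])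
    (0x120a867909 ∷ 0x321760a909 ∷ 0x6705123409 ∷ 0x7605123409 ∷ 0x8672154009 ∷ 0x345120a8670c ∷ 0xa80671234500 ∷
     0xa89675402100 ∷ []) (coloured 0x1131111131313232332320300023221300210102) ∷
  step (9 ∷ 1 ∷ 49 ∷ 1 ∷ 4 ∷ 3 ∷ 2 ∷ 2 ∷ 1 ∷ 0 ∷ [])
    (0x2179a8608 ∷ 0x674321508 ∷ 0x6701234508 ∷ 0x9761204508 ∷ 0x215460a970a ∷ [])
    (coloured 0x1311211333111121131233322000330230303003212300310210) ∷
  step (9 ∷ 1 ∷ 49 ∷ 1 ∷ 12 ∷ 3 ∷ 2 ∷ 2 ∷ 1 ∷ 0 ∷ [])
    (0x104a976807 ∷ 0x204a976807 ∷ 0xa89673451201 ∷ 0xa89673451202 ∷ 0xa89675432101 ∷ 0xa89675432102 ∷ 0xa98763451200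
     ∷ 0xa98763451201 ∷ 0xa98763451202 ∷ 0xa98763451203 ∷ 0xa98765432100 ∷ 0xa98765432101 ∷ 0xa98765432102 ∷
     0xa98765432103 ∷ []) (dominated 3 7) ∷
  step (521 ∷ 1 ∷ 49 ∷ 65 ∷ 12 ∷ 3 ∷ 2 ∷ 2 ∷ 3 ∷ 0 ∷ 0 ∷ [])
    (0x1b4670a806 ∷ 0x760b432106 ∷ 0xa8671204b08 ∷ 0xb6703215407 ∷ 0x453128a97600 ∷ 0x453128a97601 ∷ 0x453128a97602 ∷
     0xa98763451200 ∷ 0xa98763451202 ∷ []) (coloured 0x3232333033003323203000111110011121112111100220112001031) ∷
  step (521 ∷ 1 ∷ 49 ∷ 65 ∷ 12 ∷ 19 ∷ 2 ∷ 2 ∷ 1 ∷ 0 ∷ 0 ∷ [])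
    (0x1209768a05 ∷ 0x2109768a05 ∷ 0x6704512305 ∷ 0x7604512305 ∷ 0x435219a86701 ∷ 0x453129a86701 ∷ [])
    (coloured 0x220223300002230220011112111321121001320120101031) ∷
  step (521 ∷ 1 ∷ 49 ∷ 65 ∷ 12 ∷ 19 ∷ 2 ∷ 2 ∷ 1 ∷ 1 ∷ 0 ∷ [])
    (0x120679a804 ∷ 0x6701543204 ∷ 0x7601543204 ∷ []) (coloured 0x112222222222221123113303001001101330113011020320) ∷
  step (521 ∷ 1 ∷ 49 ∷ 65 ∷ 12 ∷ 19 ∷ 2 ∷ 2 ∷ 3 ∷ 0 ∷ 0 ∷ [])
    (0x231b978a04 ∷ 0x120468a9705 ∷ 0x18703456204 ∷ 0x32108ab9705 ∷ 0xba98765432100 ∷ 0xba98765432101 ∷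
     0x35796a8b402102 ∷ []) (coloured 0x30300302022000302322233113223133318333338322321802338221201) ∷
  step (521 ∷ 513 ∷ 49 ∷ 193 ∷ 12 ∷ 19 ∷ 2 ∷ 2 ∷ 7 ∷ 0 ∷ 0 ∷ 0 ∷ [])
    (0x12079a8602 ∷ 0x6705123402 ∷ 0x760512c402 ∷ 0x8a02c4b102 ∷ 0xa802c4b102 ∷ 0xa86012c402 ∷ [])
    (coloured 0x3223322211132233121111120201020000200002111022010130) ∷
  step (521 ∷ 513 ∷ 49 ∷ 193 ∷ 12 ∷ 51 ∷ 2 ∷ 2 ∷ 3 ∷ 0 ∷ 0 ∷ 0 ∷ [])
    (0x128a97601 ∷ 0x218a97601 ∷ 0x6703451201 ∷ 0x7603451201 ∷ 0x8a012c4b01 ∷ [])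
    (coloured 0x21111101112111222222220222220000110231010103) ∷
  step (521 ∷ 513 ∷ 49 ∷ 193 ∷ 12 ∷ 51 ∷ 2 ∷ 2 ∷ 7 ∷ 0 ∷ 0 ∷ 0 ∷ [])
    (0x765123400 ∷ 0x210a867900 ∷ 0x7603215400 ∷ 0xa804b12c00 ∷ [])
    (coloured 0x10111311113311122222222222000000000000001113001310202) ∷
  step (9 ∷ 1 ∷ 1 ∷ 1 ∷ 0 ∷ 1 ∷ 1 ∷ 0 ∷ [])
    (0x8761234500 ∷ 0x8761543200 ∷ 0x8763215400 ∷ 0x8763451200 ∷ 0x8765432100 ∷ 0x87602154301 ∷ []) (dominated 5 7) ∷
  step (137 ∷ 1 ∷ 33 ∷ 1 ∷ 0 ∷ 5 ∷ 1 ∷ 0 ∷ 0 ∷ [])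
    (0x1876543200 ∷ 0x67804321500 ∷ 0x87604321500 ∷ 0x8910a265400 ∷ [])
    (coloured 0x110822222102222223333331033333102223331008101023283) ∷
  step (9 ∷ 1 ∷ 1 ∷ 1 ∷ 0 ∷ 1 ∷ 1 ∷ 1 ∷ 0 ∷ [])
    (0x98765432100 ∷ 0x879601524301 ∷ []) (coloured 0x22222222222222333333333333331001810101010018101028323) ∷
  step (9 ∷ 1 ∷ 65 ∷ 1 ∷ 16 ∷ 9 ∷ 1 ∷ 1 ∷ 1 ∷ 0 ∷ [])
    (0xa963504872101 ∷ []) (coloured 0x20110221112222131113333311333100100101011200210120303) ∷
  step (3 ∷ 2 ∷ 2 ∷ 1 ∷ 0 ∷ 3 ∷ 2 ∷ 2 ∷ 1 ∷ 0 ∷ [])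
    (0x147826359a00 ∷ 0x14962735a800 ∷ 0x157836249a00 ∷ 0x236917458a00 ∷ 0x25a648139700 ∷ 0x41982a537600 ∷
     0x51983a427600 ∷ 0x6951738a4200 ∷ 0x6952748a3100 ∷ 0x7a1492683500 ∷ 0x7a1593682400 ∷ 0xa62381974500 ∷
     0x10854a6973200 ∷ 0x134902b567800 ∷ 0x136095b248700 ∷ 0x145076923a800 ∷ [])
    (coloured 0x111111112222220011202100121001) ∷
  step (33 ∷ 32 ∷ 33 ∷ 32 ∷ 6 ∷ 12 ∷ 8 ∷ 4 ∷ 2 ∷ 1 ∷ 0 ∷ [])
    [] (coloured 0x11111111111112222233330300222300000003231002010) ∷
  []) refl

2K2-K4-certificate : Certificate 4 (matching 2 ∷ clique 4 ∷ [])
2K2-K4-certificate = certificate (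
  step [] (0x1000 ∷ []) (coloured 0x0) ∷
  step (1 ∷ 0 ∷ []) (0x21000 ∷ 0x31000 ∷ []) (coloured 0x12012) ∷
  step (3 ∷ 1 ∷ 0 ∷ []) (0x2130400 ∷ 0x3412000 ∷ 0x4213000 ∷ []) (coloured 0x102213012) ∷
  step (10 ∷ 6 ∷ 3 ∷ 1 ∷ 0 ∷ [])
    (0x16430201 ∷ 0x16520301 ∷ 0x35410201 ∷ 0x43502101 ∷ 0x45602103 ∷ 0x52041303 ∷ 0x54061303 ∷ 0x54321002 ∷
     0x61435001 ∷ 0x65142001 ∷ 0x536041200 ∷ 0x65037210b ∷ 0x765132000 ∷ []) (coloured 0x1110822132003312002) ∷
  step (15 ∷ 11 ∷ 10 ∷ 6 ∷ 3 ∷ 1 ∷ 0 ∷ [])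
    (0x10452302 ∷ 0x24163001 ∷ 0x24610302 ∷ 0x28610900 ∷ 0x42617001 ∷ 0x62407502 ∷ 0x76450302 ∷ [])
    (coloured 0x32a020221313338100130322301) ∷
  step (12 ∷ 11 ∷ 6 ∷ 3 ∷ 1 ∷ 0 ∷ []) (0x23604100 ∷ 0x32605100 ∷ []) (dominated 0 5) ∷
  step (3 ∷ 10 ∷ 6 ∷ 3 ∷ 1 ∷ 0 ∷ []) (0x5341200 ∷ 0x420651307 ∷ 0x564302107 ∷ 0x654320102 ∷ []) (dominated 0 5) ∷
  step (19 ∷ 10 ∷ 6 ∷ 3 ∷ 1 ∷ 0 ∷ [])
    (0x605432108 ∷ 0x613025407 ∷ 0x614203504 ∷ 0x621043507 ∷ 0x621543005 ∷ 0x623145003 ∷ 0x631452005 ∷ 0x632105404 ∷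
     0x634501204 ∷ 0x635014207 ∷ 0x641253003 ∷ 0x642051307 ∷ 0x642351005 ∷ 0x643521003 ∷ 0x651034204 ∷ 0x651342003 ∷
     0x652043104 ∷ 0x652431003 ∷ 0x653241005 ∷ 0x654032107 ∷ 0x654132005 ∷ 0x654321000 ∷ 0x65432102b ∷ [])
    (coloured 0x31221) ∷
  step (32 ∷ 19 ∷ 10 ∷ 6 ∷ 3 ∷ 1 ∷ 0 ∷ []) (0x753462004 ∷ 0x756034206 ∷ 0x764352004 ∷ []) (dominated 0 1) ∷
  step (7 ∷ 12 ∷ 10 ∷ 6 ∷ 3 ∷ 1 ∷ 0 ∷ [])
    (0x65143203 ∷ 0x75642105 ∷ 0x76532105 ∷ 0x563702123 ∷ 0x567203100 ∷ 0x576321028 ∷ 0x657204100 ∷ 0x675402100 ∷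
     0x734561022 ∷ 0x756042124 ∷ 0x756304100 ∷ 0x765032124 ∷ 0x765043100 ∷ 0x765043203 ∷ 0x576032410a ∷ 0x5764321007
     ∷ 0x657024310a ∷ 0x6573241007 ∷ 0x750461320b ∷ 0x7562341007 ∷ []) (coloured 0x2103120) ∷
  step (7 ∷ 20 ∷ 12 ∷ 6 ∷ 3 ∷ 1 ∷ 0 ∷ [])
    (0x65742104 ∷ 0x576204103 ∷ 0x675402103 ∷ 0x673051420a ∷ 0x6751430207 ∷ []) (dominated 0 6) ∷
  step (24 ∷ 21 ∷ 12 ∷ 7 ∷ 2 ∷ 1 ∷ 0 ∷ []) (0x750643101 ∷ 0x760542101 ∷ []) (dominated 0 3) ∷
  step (41 ∷ 24 ∷ 14 ∷ 7 ∷ 2 ∷ 1 ∷ 0 ∷ [])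
    (0x702165303 ∷ 0x735061202 ∷ 0x735261000 ∷ 0x762541000 ∷ 0x763125000 ∷ []) (dominated 2 3) ∷
  step (28 ∷ 22 ∷ 13 ∷ 4 ∷ 3 ∷ 1 ∷ 0 ∷ [])
    (0x520471601 ∷ 0x630471501 ∷ 0x5762013408 ∷ 0x6735104208 ∷ 0x7654321006 ∷ []) (dominated 0 6) ∷
  step (7 ∷ 12 ∷ 11 ∷ 6 ∷ 3 ∷ 1 ∷ 0 ∷ [])
    (0x37416200 ∷ 0x35174021d ∷ 0x37140521e ∷ 0x467503100 ∷ 0x53276101d ∷ 0x537406200 ∷ 0x56370211e ∷ 0x57602411f ∷
     0x576321023 ∷ 0x67052311f ∷ 0x674350200 ∷ 0x74305121f ∷ 0x356704120d ∷ 0x3674512004 ∷ 0x4573612004 ∷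
     0x7054632115 ∷ 0x7356420106 ∷ 0x7465320106 ∷ 0x7534610206 ∷ 0x7643510206 ∷ []) (coloured 0x2011032) ∷
  step (35 ∷ 22 ∷ 13 ∷ 3 ∷ 3 ∷ 1 ∷ 0 ∷ [])
    (0x4537602111 ∷ 0x4627503111 ∷ 0x754623100c ∷ 0x764532100c ∷ []) (dominated 3 6) ∷
  step (51 ∷ 26 ∷ 14 ∷ 7 ∷ 3 ∷ 0 ∷ 0 ∷ [])
    (0x754321022 ∷ 0x672541300e ∷ 0x673215400e ∷ 0x673451200e ∷ 0x674125300e ∷ 0x675134200e ∷ []) (dominated 5 6) ∷
  step (72 ∷ 7 ∷ 20 ∷ 12 ∷ 3 ∷ 3 ∷ 1 ∷ 0 ∷ []) (0x786532407 ∷ 0x7680543202 ∷ 0x8076351203 ∷ []) (dominated 0 5) ∷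
  step (56 ∷ 44 ∷ 26 ∷ 13 ∷ 0 ∷ 3 ∷ 1 ∷ 0 ∷ [])
    (0x768325106 ∷ 0x876315409 ∷ 0x7830654202 ∷ 0x8730654102 ∷ []) (dominated 2 3) ∷
  step (96 ∷ 19 ∷ 18 ∷ 14 ∷ 7 ∷ 3 ∷ 0 ∷ 0 ∷ []) (0x6078452310 ∷ 0x6574820301 ∷ []) (dominated 0 3) ∷
  step (7 ∷ 28 ∷ 22 ∷ 13 ∷ 4 ∷ 3 ∷ 1 ∷ 0 ∷ [])
    (0x837215401 ∷ 0x8367025100 ∷ 0x8476025100 ∷ 0x8670425305 ∷ []) (dominated 0 4) ∷
  step (38 ∷ 49 ∷ 6 ∷ 13 ∷ 5 ∷ 3 ∷ 1 ∷ 0 ∷ [])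
    (0x481705317 ∷ 0x586037118 ∷ 0x673851016 ∷ 0x746801317 ∷ 0x781406317 ∷ 0x78421301c ∷ 0x825743016 ∷ 0x4568071306 ∷
     0x5478063106 ∷ 0x6708523107 ∷ 0x6748053106 ∷ 0x860475230a ∷ 0x9180367401 ∷ []) (coloured 0x21210112001212033) ∷
  step (43 ∷ 26 ∷ 21 ∷ 9 ∷ 6 ∷ 3 ∷ 1 ∷ 0 ∷ [])
    (0x124356709 ∷ 0x78652101c ∷ 0x7162058400 ∷ 0x7521086300 ∷ 0x7580642103 ∷ 0x7608531203 ∷ 0x7680251302 ∷
     0x8354067200 ∷ 0x8570613403 ∷ 0x8640375100 ∷ 0x8710534205 ∷ 0x8720643105 ∷ [])
    (coloured 0x200220011312030121231) ∷
  step (15 ∷ 41 ∷ 24 ∷ 14 ∷ 7 ∷ 2 ∷ 1 ∷ 0 ∷ [])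
    (0x193782409 ∷ 0x867542015 ∷ 0x876453015 ∷ 0x1049827309 ∷ 0x1752038908 ∷ 0x195302840c ∷ 0x4083761209 ∷
     0x5083761209 ∷ 0x803247610b ∷ 0x8230715602 ∷ 0x8320615702 ∷ 0x8320764101 ∷ 0x8547063200 ∷ 0x8654703202 ∷
     0x870354260a ∷ 0x8754602302 ∷ 0x9615783008 ∷ []) (coloured 0x303333330110000011120012033021) ∷
  step (67 ∷ 38 ∷ 28 ∷ 14 ∷ 7 ∷ 2 ∷ 1 ∷ 0 ∷ [])
    (0x43762114 ∷ 0x853762014 ∷ 0x804367210c ∷ 0x8402671309 ∷ 0x8476520102 ∷ 0x8647532007 ∷ 0x8746532007 ∷ [])
    (dominated 3 4) ∷
  step (49 ∷ 35 ∷ 22 ∷ 13 ∷ 3 ∷ 3 ∷ 1 ∷ 0 ∷ []) (0x714650212 ∷ 0x6785340100 ∷ 0x7685430100 ∷ []) (dominated 0 7) ∷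
  step (97 ∷ 35 ∷ 14 ∷ 11 ∷ 6 ∷ 3 ∷ 1 ∷ 0 ∷ [])
    (0x47652112 ∷ 0x283106511 ∷ 0x307652112 ∷ 0x705634213 ∷ 0x847652012 ∷ 0x854721018 ∷ 0x6509834102 ∷ 0x6587043108 ∷
     0x7509834102 ∷ 0x8057241308 ∷ 0x8701562407 ∷ 0x8730562407 ∷ 0x8756432002 ∷ 0x9012673507 ∷ 0x9618243002 ∷
     0x9810673507 ∷ []) (coloured 0x11121000111300332221010220323) ∷
  step (67 ∷ 28 ∷ 25 ∷ 11 ∷ 6 ∷ 3 ∷ 1 ∷ 0 ∷ []) (0x5834702100 ∷ 0x8573406204 ∷ 0x8574301201 ∷ []) (dominated 4 5) ∷
  step (49 ∷ 35 ∷ 22 ∷ 14 ∷ 7 ∷ 1 ∷ 1 ∷ 0 ∷ [])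
    (0x567081211 ∷ 0x63157200f ∷ 0x673501210 ∷ 0x751608210 ∷ 0x872453102 ∷ 0x87253100f ∷ 0x3086425101 ∷ 0x5768340100
     ∷ 0x5786403101 ∷ 0x7680541204 ∷ 0x7683540204 ∷ 0x8765043205 ∷ []) (coloured 0x21101001110110123023) ∷
  step (49 ∷ 35 ∷ 14 ∷ 11 ∷ 6 ∷ 3 ∷ 1 ∷ 0 ∷ [])
    (0x548072110 ∷ 0x84750210f ∷ 0x85240710f ∷ 0x854721014 ∷ 0x87254010e ∷ 0x1985640300 ∷ 0x5874630200 ∷ 0x6570384101
     ∷ 0x6874530200 ∷ 0x7806924103 ∷ 0x8064527102 ∷ 0x8470562103 ∷ 0x8647025100 ∷ 0x8730562404 ∷ 0x9158036200 ∷
     0x9706581202 ∷ 0x9764850103 ∷ []) (coloured 0x21222221100112213202113020) ∷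
  step (42 ∷ 44 ∷ 21 ∷ 7 ∷ 6 ∷ 3 ∷ 1 ∷ 0 ∷ [])
    (0x26805310f ∷ 0x82360510e ∷ 0x826531013 ∷ 0x85326010d ∷ 0x86502310e ∷ 0x869253103 ∷ 0x6548702300 ∷ 0x6780235105
     ∷ 0x8457306104 ∷ 0x8594761002 ∷ 0x8702653101 ∷ 0x8965071301 ∷ []) (coloured 0x333000022211223112210231001) ∷
  step (88 ∷ 53 ∷ 28 ∷ 15 ∷ 6 ∷ 3 ∷ 0 ∷ 0 ∷ []) (0x6875431001 ∷ 0x8567412001 ∷ []) (dominated 0 3) ∷
  step (51 ∷ 42 ∷ 26 ∷ 13 ∷ 5 ∷ 3 ∷ 1 ∷ 0 ∷ [])
    (0x86274100d ∷ 0x6845720101 ∷ 0x7812634000 ∷ 0x7854630101 ∷ []) (dominated 0 7) ∷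
  step (27 ∷ 52 ∷ 28 ∷ 15 ∷ 3 ∷ 2 ∷ 1 ∷ 0 ∷ [])
    (0x47806210c ∷ 0x48705310c ∷ 0x78504310b ∷ 0x4860537104 ∷ 0x6478503100 ∷ 0x7096531804 ∷ 0x7524081602 ∷
     0x8643705102 ∷ 0x68057419305 ∷ []) (coloured 0x101222330330031110001102223) ∷
  step (71 ∷ 44 ∷ 28 ∷ 14 ∷ 7 ∷ 1 ∷ 1 ∷ 0 ∷ [])
    (0x182034509 ∷ 0x632750109 ∷ 0x67205410a ∷ 0x87431600b ∷ 0x983714201 ∷ 0x5780236103 ∷ 0x5872604101 ∷ 0x6197382001
     ∷ 0x6981704201 ∷ 0x7386451001 ∷ 0x7468530101 ∷ 0x7835061201 ∷ 0x7845061201 ∷ 0x8607432502 ∷ 0x8906172301 ∷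
     0x68743051205 ∷ []) (coloured 0x332222111113100000010132220) ∷
  step (28 ∷ 54 ∷ 29 ∷ 12 ∷ 7 ∷ 3 ∷ 0 ∷ 0 ∷ [])
    (0x42873500a ∷ 0x52876400a ∷ 0x63785400a ∷ 0x76354200f ∷ 0x86354200f ∷ 0x4208735605 ∷ 0x6387540202 ∷ 0x6587320402
     ∷ 0x7854026301 ∷ 0x8726504301 ∷ 0x8732406501 ∷ 0x8746032501 ∷ 0x46387205104 ∷ [])
    (coloured 0x1100002233333122232233211200323) ∷
  step (43 ∷ 26 ∷ 22 ∷ 11 ∷ 6 ∷ 3 ∷ 1 ∷ 0 ∷ [])
    (0x381506208 ∷ 0x514380207 ∷ 0x632841007 ∷ 0x846032109 ∷ 0x8570613201 ∷ 0x8673504101 ∷ 0x57804632102 ∷ [])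
    (coloured 0x1212223133300000003113220) ∷
  step (105 ∷ 56 ∷ 30 ∷ 15 ∷ 6 ∷ 3 ∷ 0 ∷ 0 ∷ [])
    (0x457861008 ∷ 0x648725008 ∷ 0x5387016203 ∷ 0x5387160200 ∷ 0x6387250100 ∷ []) (dominated 2 3) ∷
  step (30 ∷ 51 ∷ 14 ∷ 11 ∷ 6 ∷ 3 ∷ 1 ∷ 0 ∷ [])
    (0x371652006 ∷ 0x481652006 ∷ 0x74865321001 ∷ 0x76835421000 ∷ 0x83765421001 ∷ 0x86745321000 ∷ []) (dominated 1 4) ∷
  step (195 ∷ 46 ∷ 45 ∷ 13 ∷ 11 ∷ 6 ∷ 3 ∷ 1 ∷ 0 ∷ [])
    (0x394701205 ∷ 0x574023106 ∷ 0x592740104 ∷ 0x59764200b ∷ 0x698527006 ∷ 0x739051206 ∷ 0x915370204 ∷ 0x4285076901 ∷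
     0x9785364001 ∷ 0x76985432000 ∷ 0x94785632000 ∷ []) (coloured 0x133313012220202120021230) ∷
  step (195 ∷ 46 ∷ 57 ∷ 19 ∷ 14 ∷ 7 ∷ 3 ∷ 0 ∷ 0 ∷ [])
    (0x72315603 ∷ 0x72563104 ∷ 0x95217603 ∷ 0x492653004 ∷ 0x826574005 ∷ 0x872653004 ∷ 0x916372003 ∷ 0x935701204 ∷
     0x971035204 ∷ 0x973512009 ∷ 0x8756309400 ∷ []) (coloured 0x313033310222222112010330112102) ∷
  step (31 ∷ 30 ∷ 23 ∷ 12 ∷ 6 ∷ 3 ∷ 1 ∷ 0 ∷ [])
    (0x135428004 ∷ 0x274518004 ∷ 0x314682004 ∷ 0x315682004 ∷ 0x385417004 ∷ 0x386417004 ∷ 0x487321009 ∷ 0x587321009 ∷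
     0x784523004 ∷ 0x830675103 ∷ 0x831576003 ∷ 0x835671004 ∷ 0x874632004 ∷ 0x876532004 ∷ 0x342895761001 ∷
     0x398245761001 ∷ 0x485760293100 ∷ 0x827651934000 ∷ 0x847650392100 ∷ 0x924835760101 ∷ 0x927651843000 ∷
     0x938427650101 ∷ []) (coloured 0x32222222222211110301111333333331131000221) ∷
  step (396 ∷ 122 ∷ 124 ∷ 46 ∷ 31 ∷ 12 ∷ 6 ∷ 3 ∷ 0 ∷ 0 ∷ []) (0x952761002 ∷ 0x9a3247860100 ∷ []) (dominated 2 4) ∷
  step (401 ∷ 240 ∷ 124 ∷ 62 ∷ 31 ∷ 5 ∷ 4 ∷ 3 ∷ 0 ∷ 0 ∷ [])
    (0x7349a102 ∷ 0x28a976006 ∷ 0x297103400 ∷ 0x697431001 ∷ 0x697531001 ∷ 0x7653a9002 ∷ 0x7a6432001 ∷ 0x7a6532001 ∷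
     0x7a6542001 ∷ 0x8043a6102 ∷ 0x8053a6102 ∷ 0x8054a6102 ∷ 0x8935a6002 ∷ 0x8954a6002 ∷ 0x986432001 ∷ 0xa23801601 ∷
     0xa82316006 ∷ []) (coloured 0x33000013320222211110022311112) ∷
  step (24 ∷ 12 ∷ 11 ∷ 6 ∷ 2 ∷ 1 ∷ 0 ∷ []) (0x437065201 ∷ 0x7504631202 ∷ 0x7603541202 ∷ []) (dominated 0 1) ∷
  step (9 ∷ 24 ∷ 14 ∷ 7 ∷ 2 ∷ 1 ∷ 0 ∷ []) (0x7536240101 ∷ 0x7653024102 ∷ []) (dominated 2 3) ∷
  step (3 ∷ 14 ∷ 11 ∷ 6 ∷ 3 ∷ 1 ∷ 0 ∷ [])
    (0x4327650102 ∷ 0x4637520101 ∷ 0x4726530101 ∷ 0x4765321005 ∷ []) (dominated 3 4) ∷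
  step (36 ∷ 26 ∷ 26 ∷ 9 ∷ 5 ∷ 3 ∷ 1 ∷ 0 ∷ []) (0x475382101 ∷ []) (dominated 2 5) ∷
  step (18 ∷ 56 ∷ 25 ∷ 7 ∷ 7 ∷ 2 ∷ 1 ∷ 0 ∷ []) (0x758420101 ∷ []) (dominated 1 4) ∷
  step (48 ∷ 56 ∷ 15 ∷ 11 ∷ 6 ∷ 2 ∷ 1 ∷ 0 ∷ []) (0x435082100 ∷ 0x534082100 ∷ []) (dominated 2 7) ∷
  step (0 ∷ 3 ∷ 10 ∷ 6 ∷ 3 ∷ 1 ∷ 0 ∷ []) (0x657432101 ∷ []) (dominated 0 1) ∷
  step (0 ∷ 19 ∷ 10 ∷ 6 ∷ 3 ∷ 1 ∷ 0 ∷ []) [] (dominated 0 1) ∷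
  step (64 ∷ 3 ∷ 22 ∷ 13 ∷ 3 ∷ 3 ∷ 1 ∷ 0 ∷ []) [] (dominated 4 7) ∷
  []) refl

2K2-K5-e-K6-certificate : Certificate 5 (matching 2 ∷ nearClique 3 ∷ clique 6 ∷ [])
2K2-K5-e-K6-certificate = certificate (
  step (7 ∷ 3 ∷ 1 ∷ 0 ∷ []) (0x432100c ∷ 0x25430100 ∷ 0x53421000 ∷ []) (coloured 0x211130203003210) ∷
  step (21 ∷ 12 ∷ 7 ∷ 3 ∷ 1 ∷ 0 ∷ [])
    (0x361284000 ∷ 0x463510200 ∷ 0x654321000 ∷ 0x654710200 ∷ []) (coloured 0x330803302244334114112222013224) ∷
  step (23 ∷ 21 ∷ 12 ∷ 7 ∷ 3 ∷ 1 ∷ 0 ∷ [])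
    (0x6371504200 ∷ 0x6475130201 ∷ 0x6572140303 ∷ 0x6751432002 ∷ 0x6857314001 ∷ 0x7586140301 ∷ 0x7634250100 ∷
     0x7641253003 ∷ 0x7642531002 ∷ 0x7654321001 ∷ 0x7654810202 ∷ 0x7846150300 ∷ [])
    (coloured 0x44031111002324300233321100002130012) ∷
  step (60 ∷ 46 ∷ 27 ∷ 10 ∷ 6 ∷ 3 ∷ 1 ∷ 0 ∷ [])
    (0x2158064701 ∷ 0x4687021302 ∷ 0x4698152000 ∷ 0x6821475001 ∷ 0x6849210500 ∷ 0x6981430201 ∷ 0x7583160400 ∷
     0x7831564001 ∷ 0x7951384001 ∷ 0x7954138002 ∷ 0x8461520702 ∷ 0x8645201301 ∷ 0x8716293001 ∷ 0x8754361001 ∷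
     0x9730458102 ∷ []) (coloured 0x233010034040022111222400110021033414) ∷
  step (30 ∷ 23 ∷ 21 ∷ 12 ∷ 7 ∷ 3 ∷ 1 ∷ 0 ∷ [])
    (0x6784150301 ∷ 0x6871534000 ∷ 0x7683250401 ∷ 0x8561470301 ∷ 0x8654731000 ∷ 0x8752364001 ∷ 0x8753642000 ∷ [])
    (coloured 0x11003300300222111123424320022110021300132) ∷
  step (88 ∷ 29 ∷ 26 ∷ 15 ∷ 4 ∷ 3 ∷ 1 ∷ 0 ∷ [])
    (0x7485260300 ∷ 0x8571490300 ∷ 0x8670541300 ∷ 0x8672540300 ∷ 0x9750481600 ∷ 0x89534170603 ∷ [])
    (coloured 0x4440001144230103223232232110023001123) ∷
  step (92 ∷ 54 ∷ 29 ∷ 9 ∷ 3 ∷ 3 ∷ 1 ∷ 0 ∷ [])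
    (0x57910642300 ∷ 0x58910643200 ∷ 0x75941602800 ∷ 0x85672401300 ∷ 0x85761402300 ∷ 0x85941603700 ∷ 0x86741532002 ∷
     0x87642531002 ∷ 0x91783502400 ∷ 0x91872503400 ∷ 0x521974360801 ∷ 0x531984260701 ∷ 0x794251860303 ∷
     0x894351760203 ∷ 0x947512836003 ∷ 0x948513726003 ∷ [])
    (coloured 0x3333003300224344221311211400142114200031020241) ∷
  step (180 ∷ 114 ∷ 58 ∷ 25 ∷ 13 ∷ 7 ∷ 3 ∷ 0 ∷ 0 ∷ [])
    (0x28a10375401 ∷ 0x48095621301 ∷ 0x591a6702401 ∷ 0x610a5247301 ∷ 0x748a0916204 ∷ 0x867a4190204 ∷ 0x8a293170501 ∷
     0x96745812001 ∷ 0x97642815001 ∷ 0xa7851923001 ∷ 0xa7856120901 ∷ 0xa8750926101 ∷ 0x531a82690700 ∷ 0x6789a0254103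
     ∷ 0x8a2351790602 ∷ 0x982075a61303 ∷ []) (coloured 0x3333343331130031244220042220022122400324101102) ∷
  step (63 ∷ 103 ∷ 101 ∷ 44 ∷ 23 ∷ 7 ∷ 6 ∷ 3 ∷ 1 ∷ 0 ∷ [])
    (0x9ab6375103 ∷ 0x21385649000 ∷ 0x23189645000 ∷ 0x3149672a000 ∷ 0x5178246a000 ∷ 0x69358201a00 ∷ 0x761a9354000 ∷
     0x940ba375103 ∷ 0x98a06b75103 ∷ 0x2438a9150701 ∷ 0x2438a9156001 ∷ 0x32498a167001 ∷ 0x432a98170601 ∷
     0x6759a8132001 ∷ 0x756a89140201 ∷ 0x756a89143001 ∷ 0x857a64109202 ∷ 0x934a27108602 ∷ 0xa76953108402 ∷ [])
    (coloured 0x40214332211111111300300010100214022103) ∷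
  step (120 ∷ 90 ∷ 60 ∷ 15 ∷ 13 ∷ 4 ∷ 3 ∷ 1 ∷ 0 ∷ [])
    (0x14a786923001 ∷ 0x49a067813200 ∷ 0x51792638a000 ∷ 0x594187a30601 ∷ 0x8a4370951600 ∷ 0x9a4671850300 ∷ [])
    (coloured 0x31133333112221442133300434421040400402010041120240) ∷
  step (158 ∷ 55 ∷ 77 ∷ 56 ∷ 23 ∷ 7 ∷ 6 ∷ 3 ∷ 1 ∷ 0 ∷ [])
    (0x89176b3a001 ∷ 0x3a8046912700 ∷ 0x69a7b1508300 ∷ [])
    (coloured 0x2011002042224122303304343422233331104100212143) ∷
  step (397 ∷ 184 ∷ 79 ∷ 27 ∷ 22 ∷ 14 ∷ 7 ∷ 1 ∷ 1 ∷ 0 ∷ []) [] (coloured 0x1123444211343132020332011422002130014340) ∷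
  step (176 ∷ 106 ∷ 58 ∷ 29 ∷ 13 ∷ 7 ∷ 3 ∷ 0 ∷ 0 ∷ [])
    [] (coloured 0x24222422333333000331113311130003111000000231010013) ∷
  step (15 ∷ 7 ∷ 3 ∷ 1 ∷ 0 ∷ []) [] (coloured 0x211113220000000043210) ∷
  []) refl

module _ (G : Graph (Fin n)) where

  2K2-diamond-K4-colourable : Free (pK2 2) G → ¬ NearClique G 2 → ¬ HasClique G 4 → Colourable G 3
  2K2-diamond-K4-colourable 2K2-free diamond-free K4-free =
    certified 2K2-diamond-K4-certificate (λ { G _ (avoids ∷ _) → avoids-[] G avoids }) G
      (avoids-matching G 2 2K2-free ∷ avoids-nearClique G 2 diamond-free ∷ avoids-clique G 4 K4-free ∷ [])

  3K2-K3-colourable : Free (pK2 3) G → ¬ HasClique G 3 → Colourable G 4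
  3K2-K3-colourable 3K2-free K3-free =
    certified 3K2-K3-certificate (λ { G _ (avoids ∷ _) → avoids-[] G avoids }) G
      (avoids-matching G 3 3K2-free ∷ avoids-clique G 3 K3-free ∷ [])

  2K2-K4-colourable : Avoids G (matchingPattern 2) → Avoids G (cliquePattern 4) → Colourable G 4
  2K2-K4-colourable avoids-2K2 avoids-K4 =
    certified 2K2-K4-certificate (λ { G _ (avoids ∷ _) → avoids-[] G avoids }) G (avoids-2K2 ∷ avoids-K4 ∷ [])

2K2-K5-e-K6-colourable : (G : Graph (Fin n)) → Free (pK2 2) G → ¬ NearClique G 3 → ¬ HasClique G 6 → Colourable G 5
2K2-K5-e-K6-colourable G 2K2-free K5-e-free K6-free = certified 2K2-K5-e-K6-certificate
  (λ { G (avoids-2K2 ∷ _) (avoids-K4 ∷ _) →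
    colourable-mono G (ℕ.n≤1+n 4) (2K2-K4-colourable G avoids-2K2 avoids-K4) }) G
  (avoids-matching G 2 2K2-free ∷ avoids-nearClique G 3 K5-e-free ∷ avoids-clique G 6 K6-free ∷ [])

-- Triangle-free and diamond-free graphs

triangle-free-colourable : ∀ p (G : Graph (Fin n)) → Free (pK2 (3 + p)) G → ¬ HasClique G 3 → Colourable G (2 * (2 + p))
triangle-free-colourable zero    G pK2-free triangle-free = 3K2-K3-colourable G pK2-free triangle-free
triangle-free-colourable (suc p) G pK2-free triangle-free with edge? G
... | inj₂ edgeless      = colourable-mono G (ℕ.s≤s ℕ.z≤n) (edgeless-colourable G edgeless)
... | inj₁ (u , v , u~v) = subst (Colourable G) (≡-sym (ℕ.*-suc 2 (2 + p)))
  (near-far-colourable G (clique-free⇒near-clique-free G triangle-free) triangle-free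
    (far-colourable G u~v pK2-free λ ι _ pK2-free′ →
      triangle-free-colourable p (restrict G ι) pK2-free′ (triangle-free ∘ hasClique-restrict G ι)))

2K2-diamond-colourable : ∀ m (G : Graph (Fin n)) → Free (pK2 2) G → ¬ NearClique G 2 → ¬ HasClique G (4 + m) →
                         Colourable G (3 + m)
2K2-diamond-colourable zero    G 2K2-free diamond-free K4-free =
  2K2-diamond-K4-colourable G 2K2-free diamond-free K4-free
2K2-diamond-colourable (suc m) G 2K2-free diamond-free clique-free with hasClique? G (4 + m)
... | yes K = large-clique-colourable G 1 2K2-free diamond-free (ℕ.m≤m+n 4 m) K clique-free
... | no ¬K = colourable-mono G (ℕ.n≤1+n (3 + m)) (2K2-diamond-colourable m G 2K2-free diamond-free ¬K)

g-at-2 : ∀ p → 2 * (2 + p) ≡ g (3 + p) 2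
g-at-2 p = ℕ.*-distribˡ-∸ 2 (3 + p) 1

g-recursion : ∀ p m → (2 + m) + (2 + m) + g (2 + p) (3 + m) ≡ g (3 + p) (3 + m)
g-recursion p m = begin
  (2 + m) + (2 + m) + g (2 + p) (3 + m)    ≡⟨ ℕ.+-comm _ (g (2 + p) (3 + m)) ⟩
  g (2 + p) (3 + m) + ((2 + m) + (2 + m))  ≡⟨ cong (λ i → g (2 + p) (3 + m) + ((2 + m) + i)) (ℕ.+-identityʳ (2 + m)) ⟨
  g (2 + p) (3 + m) + 2 * (2 + m)          ≡⟨ cong (g (2 + p) (3 + m) +_) (ℕ.*-distribˡ-∸ 2 (3 + m) 1) ⟩
  g (3 + p) (3 + m)                        ∎
  where open ≡-Reasoning

diamond-free-colourable : ∀ p m (G : Graph (Fin n)) → Free (pK2 (2 + p)) G → ¬ NearClique G 2 → ¬ HasClique G (3 + m) →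
                          Colourable G (g (2 + p) (2 + m))
diamond-free-colourable zero    zero    G pK2-free diamond-free triangle-free =
  2K2-diamond-K4-colourable G pK2-free diamond-free (triangle-free ∘ hasClique-≤ G (ℕ.n≤1+n 3))
diamond-free-colourable zero    (suc m) G pK2-free diamond-free clique-free =
  2K2-diamond-colourable m G pK2-free diamond-free clique-free
diamond-free-colourable (suc p) zero    G pK2-free diamond-free triangle-free =
  subst (Colourable G) (g-at-2 p) (triangle-free-colourable p G pK2-free triangle-free)
diamond-free-colourable (suc p) (suc m) G pK2-free diamond-free clique-free with edge? G
... | inj₂ edgeless      =
  colourable-mono G (ℕ.m≤n⇒m≤o+n (g (2 + p) (3 + m)) (ℕ.s≤s ℕ.z≤n)) (edgeless-colourable G edgeless)
... | inj₁ (u , v , u~v) = subst (Colourable G) (g-recursion p m)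
  (near-far-colourable G diamond-free clique-free
    (far-colourable G u~v pK2-free λ ι ι-injective pK2-free′ →
      diamond-free-colourable p (suc m) (restrict G ι) pK2-free′
        (diamond-free ∘ nearClique-restrict G ι ι-injective) (clique-free ∘ hasClique-restrict G ι)))

-- Graphs without K₅ − e

2K2-K5-e-colourable : ∀ m (G : Graph (Fin n)) → Free (pK2 2) G → ¬ NearClique G 3 → ¬ HasClique G (6 + m) →
                      Colourable G (5 + m)
2K2-K5-e-colourable zero    G 2K2-free K5-e-free clique-free = 2K2-K5-e-K6-colourable G 2K2-free K5-e-free clique-free
2K2-K5-e-colourable (suc m) G 2K2-free K5-e-free clique-free with hasClique? G (6 + m)
... | yes K = large-clique-colourable G 2 2K2-free K5-e-free (ℕ.m≤m+n 6 m) K clique-free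
... | no ¬K = colourable-mono G (ℕ.n≤1+n (5 + m)) (2K2-K5-e-colourable m G 2K2-free K5-e-free ¬K)

f-at-3 : ∀ p → f (3 + p) 3 ≡ 13 + 9 * p + 2 * p * p
f-at-3 p = begin
  2 * (3 + p) * (3 + p) + 4 ∸ 3 * (3 + p)               ≡⟨ cong (_∸ 3 * (3 + p)) (expand p) ⟩
  3 * (3 + p) + (13 + 9 * p + 2 * p * p) ∸ 3 * (3 + p)  ≡⟨ ℕ.m+n∸m≡n (3 * (3 + p)) _ ⟩
  13 + 9 * p + 2 * p * p                                ∎
  where
  open ≡-Reasoning
  expand : ∀ p → 2 * (3 + p) * (3 + p) + 4 ≡ 3 * (3 + p) + (13 + 9 * p + 2 * p * p)
  expand = solve-∀

-- The recursion also holds at 3, where f is given in closed form.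
f-recursion : ∀ p m → f (2 + p) (3 + m) + 2 * g (2 + p) (2 + m) + 3 * (1 + m) ≡ f (3 + p) (3 + m)
f-recursion p       (suc m) = cong (f (2 + p) (4 + m) + 2 * g (2 + p) (3 + m) +_) (ℕ.*-distribˡ-∸ 3 (4 + m) 2)
f-recursion zero    zero    = refl
f-recursion (suc p) zero    = begin
  f (3 + p) 3 + 2 * g (3 + p) 2 + 3               ≡⟨ cong₂ (λ a b → a + 2 * b + 3) (f-at-3 p) (≡-sym (g-at-2 p)) ⟩
  13 + 9 * p + 2 * p * p + 2 * (2 * (2 + p)) + 3  ≡⟨ expand p ⟩
  13 + 9 * (1 + p) + 2 * (1 + p) * (1 + p)        ≡⟨ f-at-3 (suc p) ⟨
  f (4 + p) 3                                     ∎
  where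
  open ≡-Reasoning
  expand : ∀ p → 13 + 9 * p + 2 * p * p + 2 * (2 * (2 + p)) + 3 ≡ 13 + 9 * (1 + p) + 2 * (1 + p) * (1 + p)
  expand = solve-∀

f-lower-bound : ∀ p m → 2 * (1 + p) ≤ f (2 + p) (3 + m)
f-lower-bound zero    zero          = ℕ.s≤s (ℕ.s≤s ℕ.z≤n)
f-lower-bound zero    (suc zero)    = ℕ.s≤s (ℕ.s≤s ℕ.z≤n)
f-lower-bound zero    (suc (suc m)) = ℕ.s≤s (ℕ.s≤s ℕ.z≤n)
f-lower-bound (suc p) m             = begin
  2 * (2 + p)                                              ≡⟨ ℕ.*-suc 2 (1 + p) ⟩
  2 + 2 * (1 + p)                                          ≡⟨ ℕ.+-comm 2 (2 * (1 + p)) ⟩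
  2 * (1 + p) + 2                                          ≤⟨ ℕ.+-mono-≤ (f-lower-bound p m) 2≤3*[1+m] ⟩
  f (2 + p) (3 + m) + 3 * (1 + m)                          ≤⟨ ℕ.+-monoˡ-≤ (3 * (1 + m)) (ℕ.m≤m+n _ _) ⟩
  f (2 + p) (3 + m) + 2 * g (2 + p) (2 + m) + 3 * (1 + m)  ≡⟨ f-recursion p m ⟩
  f (3 + p) (3 + m)                                        ∎
  where
  open ℕ.≤-Reasoning
  2≤3*[1+m] : 2 ≤ 3 * (1 + m)
  2≤3*[1+m] = ℕ.≤-trans (ℕ.n≤1+n 2) (ℕ.m≤m*n 3 (1 + m))

module _ (G : Graph (Fin n)) where

  open Adjacency G

  private-neighbourhood-colourable : ∀ p m → Free (pK2 (3 + p)) G → ¬ NearClique G 3 → ¬ HasClique G (4 + m) →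
    ∀ a {u v} → u ~ v → Colourable (G ↾ (λ x → a ~ x × Far G u v x)) (g (2 + p) (2 + m))
  private-neighbourhood-colourable p m pK2-free K5-e-free clique-free a {u} {v} u~v =
    colourable-subset G (λ x → (a ~? x) ×-dec far? G u v x) λ ι ι-injective near-a →
      diamond-free-colourable p m (restrict G ι)
        (far-matching-free G ι u~v ι-injective (proj₂ ∘ near-a) pK2-free)
        (λ diamond → K5-e-free (extend-nearClique G (nearClique-restrict G ι ι-injective diamond)
          (proj₁ (near-a _)) (proj₁ (near-a _)) (λ i → proj₁ (near-a _))))
        (λ (c , _ , isClique) → clique-free (isClique⇒hasClique G (isClique-∷ G (λ i → proj₁ (near-a (c i))) isClique)))

  around-triangle : ∀ {a b c} x → (Far G a b x ⊎ (a ~ x × Far G b c x ⊎ b ~ x × Far G a c x)) ⊎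
                                  (a ~ x × b ~ x ⊎ (a ~ x × c ~ x ⊎ b ~ x × c ~ x))
  around-triangle {a} {b} {c} x with a ~? x | b ~? x | c ~? x
  ... | no ¬a~x | no ¬b~x | _       = inj₁ (inj₁ (¬~⇒≁ ¬a~x , ¬~⇒≁ ¬b~x))
  ... | yes a~x | no ¬b~x | no ¬c~x = inj₁ (inj₂ (inj₁ (a~x , ¬~⇒≁ ¬b~x , ¬~⇒≁ ¬c~x)))
  ... | no ¬a~x | yes b~x | no ¬c~x = inj₁ (inj₂ (inj₂ (b~x , ¬~⇒≁ ¬a~x , ¬~⇒≁ ¬c~x)))
  ... | yes a~x | yes b~x | _       = inj₂ (inj₁ (a~x , b~x))
  ... | yes a~x | no _    | yes c~x = inj₂ (inj₂ (inj₁ (a~x , c~x)))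
  ... | no _    | yes b~x | yes c~x = inj₂ (inj₂ (inj₂ (b~x , c~x)))

  triangle-colourable : ∀ p m → Free (pK2 (3 + p)) G → ¬ NearClique G 3 → ¬ HasClique G (4 + m) →
    ∀ {a b c} → a ~ b → a ~ c → b ~ c → Colourable (G ↾ Far G a b) (f (2 + p) (3 + m)) →
    Colourable G (f (3 + p) (3 + m))
  triangle-colourable p m pK2-free K5-e-free clique-free {a} {b} a~b a~c b~c far = subst (Colourable G) count
    (colourable-cover G around-triangle (colourable-∪ G
      (colourable-∪ G far (colourable-∪ G (private-neighbourhood a b~c) (private-neighbourhood b a~c)))
      (colourable-∪ G (edge-neighbourhood a~b) (colourable-∪ G (edge-neighbourhood a~c) (edge-neighbourhood b~c)))))
    where
    private-neighbourhood : ∀ x {u v} → u ~ v → Colourable (G ↾ (λ y → x ~ y × Far G u v y)) (g (2 + p) (2 + m))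
    private-neighbourhood = private-neighbourhood-colourable p m pK2-free K5-e-free clique-free
    edge-neighbourhood : ∀ {u v} → u ~ v → Colourable (G ↾ (λ y → u ~ y × v ~ y)) (suc m)
    edge-neighbourhood = edge-neighbourhood-colourable G K5-e-free clique-free
    collect : ∀ x y z → x + (y + y) + (z + (z + z)) ≡ x + 2 * y + 3 * z
    collect = solve-∀
    count : f (2 + p) (3 + m) + (g (2 + p) (2 + m) + g (2 + p) (2 + m)) + (suc m + (suc m + suc m)) ≡ f (3 + p) (3 + m)
    count = trans (collect (f (2 + p) (3 + m)) (g (2 + p) (2 + m)) (suc m)) (f-recursion p m)

2K2-K5-e-free-colourable : ∀ m (G : Graph (Fin n)) → Free (pK2 2) G → ¬ NearClique G 3 → ¬ HasClique G (3 + m) →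
                           Colourable G (f 2 (2 + m))
2K2-K5-e-free-colourable 0 G 2K2-free _ K3-free =
  diamond-free-colourable 0 0 G 2K2-free (clique-free⇒near-clique-free G K3-free) K3-free
2K2-K5-e-free-colourable 1 G 2K2-free _ K4-free =
  2K2-K4-colourable G (avoids-matching G 2 2K2-free) (avoids-clique G 4 K4-free)
2K2-K5-e-free-colourable 2 G 2K2-free K5-e-free K5-free =
  colourable-mono G (ℕ.n≤1+n 5) (2K2-K5-e-colourable 0 G 2K2-free K5-e-free (K5-free ∘ hasClique-≤ G (ℕ.n≤1+n 5)))
2K2-K5-e-free-colourable (suc (suc (suc m))) G 2K2-free K5-e-free clique-free =
  2K2-K5-e-colourable m G 2K2-free K5-e-free clique-free

K5-e-free-colourable : ∀ p m (G : Graph (Fin n)) → Free (pK2 (2 + p)) G → ¬ NearClique G 3 → ¬ HasClique G (suc m) →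
                       Colourable G (f (2 + p) m)
K5-e-free-colourable p       0 G _ _ empty    = vertexless-colourable G empty
K5-e-free-colourable p       1 G _ _ edgeless = edgeless-colourable G edgeless
K5-e-free-colourable zero    (suc (suc m)) G 2K2-free K5-e-free clique-free =
  2K2-K5-e-free-colourable m G 2K2-free K5-e-free clique-free
K5-e-free-colourable (suc p) 2 G pK2-free _ K3-free =
  subst (Colourable G) (g-at-2 p) (triangle-free-colourable p G pK2-free K3-free)
K5-e-free-colourable (suc p) (suc (suc (suc m))) G pK2-free K5-e-free clique-free with triangle? G
... | inj₂ K3-free = colourable-mono G (f-lower-bound (suc p) m) (triangle-free-colourable p G pK2-free K3-free)
... | inj₁ (a , b , c , a~b , a~c , b~c) = triangle-colourable G p m pK2-free K5-e-free clique-free a~b a~c b~c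
  (far-colourable G a~b pK2-free λ ι ι-injective pK2-free′ →
    K5-e-free-colourable p (3 + m) (restrict G ι) pK2-free′
      (K5-e-free ∘ nearClique-restrict G ι ι-injective) (clique-free ∘ hasClique-restrict G ι))

nearCliqueAdj : Fin (2 + m) → Fin (2 + m) → Bool
nearCliqueAdj (suc (suc i)) (suc (suc j)) = not (does (i Fin.≟ j))
nearCliqueAdj (suc (suc i)) _             = true
nearCliqueAdj _             (suc (suc j)) = true
nearCliqueAdj _             _             = false

K5-e-adj≡nearCliqueAdj : ∀ i j → K5-e-adj i j ≡ nearCliqueAdj i j
K5-e-adj≡nearCliqueAdj = from-yes (all? λ i → all? λ j → K5-e-adj i j Bool.≟ nearCliqueAdj i j)

module _ (G : Graph V) (N : NearClique G m) where

  open Adjacency G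
  open NearClique N

  nearCliqueVertex : Fin (2 + m) → V
  nearCliqueVertex = a Vector.∷ b Vector.∷ base

  nearCliqueVertex-injective : ∀ i j → nearCliqueVertex i ≡ nearCliqueVertex j → i ≡ j
  nearCliqueVertex-injective zero          zero          _   = refl
  nearCliqueVertex-injective zero          (suc zero)    a≡b = contradiction a≡b a≢b
  nearCliqueVertex-injective zero          (suc (suc j)) a≡c = contradiction a≡c (~⇒≢ (a~base j))
  nearCliqueVertex-injective (suc zero)    zero          b≡a = contradiction (≡-sym b≡a) a≢b
  nearCliqueVertex-injective (suc zero)    (suc zero)    _   = refl
  nearCliqueVertex-injective (suc zero)    (suc (suc j)) b≡c = contradiction b≡c (~⇒≢ (b~base j))
  nearCliqueVertex-injective (suc (suc i)) zero          c≡a = contradiction (≡-sym c≡a) (~⇒≢ (a~base i))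
  nearCliqueVertex-injective (suc (suc i)) (suc zero)    c≡b = contradiction (≡-sym c≡b) (~⇒≢ (b~base i))
  nearCliqueVertex-injective (suc (suc i)) (suc (suc j)) c≡d =
    cong (λ i → suc (suc i)) (isClique-injective G isClique c≡d)

  nearCliqueVertex-adj : ∀ i j → nearCliqueAdj i j ≡ adj G (nearCliqueVertex i) (nearCliqueVertex j)
  nearCliqueVertex-adj zero          zero          = ≡-sym (irrefl G a)
  nearCliqueVertex-adj zero          (suc zero)    = ≡-sym a≁b
  nearCliqueVertex-adj zero          (suc (suc j)) = ≡-sym (a~base j)
  nearCliqueVertex-adj (suc zero)    zero          = ≡-sym (≁-sym a≁b)
  nearCliqueVertex-adj (suc zero)    (suc zero)    = ≡-sym (irrefl G b)
  nearCliqueVertex-adj (suc zero)    (suc (suc j)) = ≡-sym (b~base j)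
  nearCliqueVertex-adj (suc (suc i)) zero          = ≡-sym (~-sym (a~base i))
  nearCliqueVertex-adj (suc (suc i)) (suc zero)    = ≡-sym (~-sym (b~base i))
  nearCliqueVertex-adj (suc (suc i)) (suc (suc j)) with i Fin.≟ j
  ... | yes refl = ≡-sym (irrefl G (base i))
  ... | no i≢j   = ≡-sym (isClique i j i≢j)

K5-e-free⇒near-clique-free : (G : Graph V) → Free K5-e G → ¬ NearClique G 3
K5-e-free⇒near-clique-free G free N = free
  ( nearCliqueVertex G N
  , nearCliqueVertex-injective G N _ _
  , λ i j → trans (K5-e-adj≡nearCliqueAdj i j) (nearCliqueVertex-adj G N i j) )

theorem3p7 : (p : ℕ) → 2 ≤ p → (n : ℕ) (G : Graph (Fin n)) →
    Free (pK2 p) G → Free K5-e G →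
    (w : ℕ) → IsCliqueNumber G w → Colourable G (f p w)
theorem3p7 (suc (suc p)) (ℕ.s≤s (ℕ.s≤s ℕ.z≤n)) n G pK2-free K5-e-free w (_ , clique-free) =
  K5-e-free-colourable p w G pK2-free (K5-e-free⇒near-clique-free G K5-e-free) clique-free
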